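{- Let $\mathbb{K}$ be a field of characteristic zero and let $n$ be a positive integer. There is no finite SAGBI basis for the invariant ring $\mathcal{I}_n$ if the monomial order on $\mathbb{K}[x_{\{i,j\}}]$ is either lexicographic, or degree lexicographic, or degree reverse lexicographic with the $n-1$ smallest variables corresponding to adjacent edges.
   Context: Let $\mathbb{K}[x_{\{i,j\}}]$ be the polynomial ring in $\binom n2$ variables indexed by the pairs $\{i,j\}$, $1\le i<j\le n$. The variable $x_{\{i,j\}}$ corresponds to the edge $\{i,j\}$ of the complete graph on $\{1,\dots,n\}$; two edges are adjacent when they share a vertex. The symmetric group $\mathfrak{S}_n$ acts by $\sigma\cdot x_{\{i,j\}}=x_{\{\sigma(i),\sigma(j)\}}$, and $\mathcal{I}_n:=\mathbb{K}[x_{\{i,j\}}]^{\mathfrak{S}_n}$ is the ring of invariant polynomials. Given a monomial order, a SAGBI basis of a subalgebra $A$ of a polynomial ring is a subset $S\subseteq A$ such that the initial (leading) monomials of the elements of $S$ generate, as a $\mathbb{K}$-algebra, the initial algebra of $A$ (the $\mathbb{K}$-span of the initial monomials of all nonzero elements of $A$).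
   Formalization: The formal theorem assumes n ≥ 4 instead of n positive, because for n = 1, 2, 3 the invariant ring is K, K[x], or the symmetric polynomials in three variables, each of which has a finite SAGBI basis. -}

module Defs where

open import Level using (Level; 0ℓ; _⊔_)
open import Algebra.Apartness.Bundles using (HeytingCommutativeRing; HeytingField)
open import Algebra.Bundles using (CommutativeRing)
import Algebra.Definitions.RawMonoid as RawMonoidDefs
open import Data.Bool.Base using (if_then_else_)
open import Data.Empty using (⊥-elim-irr)
open import Data.Fin.Base as Fin using (Fin; toℕ)
open import Data.Fin.Permutation using (Permutation′; _⟨$⟩ʳ_; flip)
import Data.Fin.Properties as Fin
open import Data.List.Base using (List; []; [_]; _++_; map; foldr; cartesianProductWith)
open import Data.List.Membership.Propositional using (_∈_)
open import Data.Nat.Base as ℕ using (ℕ; _∸_)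
open import Data.Nat.Combinatorics using (_C_)
import Data.Nat.Properties as ℕ
open import Data.Product.Base using (∃-syntax; _×_; _,_; map₂)
open import Data.Sum.Base using (_⊎_)
open import Data.Vec.Base using (Vec; lookup; replicate; sum; tabulate; zipWith)
open import Data.Vec.Properties using (≡-dec)
open import Data.Vec.Relation.Binary.Lex.Strict using (Lex-<)
open import Function.Bundles using (_↔_; _⇔_; Inverse; Injection)
open import Function.Properties.Inverse using (↔⇒↣)
open import Relation.Binary.Core using (Rel)
open import Relation.Binary.Definitions using (DecidableEquality; tri<; tri≈; tri>)
open import Relation.Binary.PropositionalEquality using (_≡_; _≢_)
open import Relation.Nullary using (does)
open import Relation.Unary using (Pred; _⊆_)

-- The pair {i , j}, stored with its smaller element first.  The ordering
-- proof is irrelevant, so equality of edges is equality of pairs.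
record Edge (n : ℕ) : Set where
  constructor edge
  field
    lo hi  : Fin n
    .lo<hi : lo Fin.< hi

open Edge public

⟪_,_⟫ : ∀ {n} (i j : Fin n) → .(i ≢ j) → Edge n
⟪ i , j ⟫ i≢j with Fin.<-cmp i j
... | tri< i<j _ _ = edge i j i<j
... | tri≈ _ i≡j _ = ⊥-elim-irr (i≢j i≡j)
... | tri> _ _ j<i = edge j i j<i

_∈ᵉ_ : ∀ {n} → Fin n → Edge n → Set
v ∈ᵉ e = v ≡ lo e ⊎ v ≡ hi e

Adjacent : ∀ {n} → Rel (Edge n) 0ℓ
Adjacent e e′ = ∃[ v ] v ∈ᵉ e × v ∈ᵉ e′

_·ᵉ_ : ∀ {n} → Permutation′ n → Edge n → Edge n
σ ·ᵉ edge i j i<j =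
  ⟪ σ ⟨$⟩ʳ i , σ ⟨$⟩ʳ j ⟫ (λ σi≡σj → Fin.<⇒≢ i<j (Injection.injective (↔⇒↣ σ) σi≡σj))

-- Monomials in x₀ , … , x_{N-1}, given by their exponents.  In the three
-- orders below the variables decrease: x₀ > x₁ > … > x_{N-1}.
Monomial : ℕ → Set
Monomial N = Vec ℕ N

_≟ᵐ_ : ∀ {N} → DecidableEquality (Monomial N)
_≟ᵐ_ = ≡-dec ℕ._≟_

degree : ∀ {N} → Monomial N → ℕ
degree = sum

module _ {N : ℕ} where

  Lex : Rel (Monomial N) 0ℓ
  Lex = Lex-< _≡_ ℕ._<_

  DegLex : Rel (Monomial N) 0ℓ
  DegLex p q = degree p ℕ.< degree q ⊎ (degree p ≡ degree q × Lex p q)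

  -- At the smallest variable where the exponents differ, the smaller
  -- monomial has the larger exponent.
  RevLex : Rel (Monomial N) 0ℓ
  RevLex p q = ∃[ k ] lookup q k ℕ.< lookup p k
                    × (∀ l → k Fin.< l → lookup p l ≡ lookup q l)

  DegRevLex : Rel (Monomial N) 0ℓ
  DegRevLex p q = degree p ℕ.< degree q ⊎ (degree p ≡ degree q × RevLex p q)

-- A total order on the variables x_{i,j} is given by listing the edges in
-- decreasing order of their variables: under ε the variable x_k above is
-- the variable of the edge ε k.
VariableOrder : ℕ → Set
VariableOrder n = Fin (n C 2) ↔ Edge n

module _ {n : ℕ} (ε : VariableOrder n) where

  edgeOf : Fin (n C 2) → Edge n
  edgeOf = Inverse.to ε

  indexOf : Edge n → Fin (n C 2)
  indexOf = Inverse.from ε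

  SmallestAdjacent : Set
  SmallestAdjacent = ∀ k l → isSmall k → isSmall l → k ≢ l → Adjacent (edgeOf k) (edgeOf l)
    where
    -- x_k is one of the n ∸ 1 smallest variables
    isSmall : Fin (n C 2) → Set
    isSmall k = n C 2 ∸ (n ∸ 1) ℕ.≤ toℕ k

  -- As σ sends x_e to x_{σ e}, the exponent of x_e in σ · m is the
  -- exponent of x_{σ⁻¹ e} in m.
  actᵐ : Permutation′ n → Monomial (n C 2) → Monomial (n C 2)
  actᵐ σ m = tabulate λ k → lookup m (indexOf (flip σ ·ᵉ edgeOf k))

module _ {c ℓ₁ ℓ₂ : Level} (K : HeytingField c ℓ₁ ℓ₂) where

  open HeytingField K
    using (Carrier; _≈_; _#_; _+_; _*_; 0#; 1#; heytingCommutativeRing)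

  open HeytingCommutativeRing heytingCommutativeRing using (commutativeRing)
  open RawMonoidDefs (CommutativeRing.+-rawMonoid commutativeRing)
    using () renaming (_×_ to _×ᴷ_)

  CharacteristicZero : Set ℓ₁
  CharacteristicZero = ∀ k → k ×ᴷ 1# ≈ 0# → k ≡ 0

  -- Polynomials in x₀ , … , x_{N-1}: a formal sum of terms, in which a
  -- monomial may occur repeatedly; two are equal when their coefficients are.
  Poly : ℕ → Set c
  Poly N = List (Carrier × Monomial N)

  module _ {N : ℕ} where

    coeff : Poly N → Monomial N → Carrier
    coeff f m = foldr (λ (a , p) s → (if does (p ≟ᵐ m) then a else 0#) + s) 0# f

    infix 4 _≈ᵖ_

    _≈ᵖ_ : Rel (Poly N) ℓ₁
    f ≈ᵖ g = ∀ m → coeff f m ≈ coeff g m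

    monomial : Monomial N → Poly N
    monomial m = [ 1# , m ]

    constant : Carrier → Poly N
    constant a = [ a , replicate N 0 ]

    _+ᵖ_ : Poly N → Poly N → Poly N
    _+ᵖ_ = _++_

    _*ᵖ_ : Poly N → Poly N → Poly N
    _*ᵖ_ = cartesianProductWith λ (a , p) (b , q) → a * b , zipWith ℕ._+_ p q

    -- The K-subalgebra generated by a set of monomials.
    data GeneratedAlgebra {s} (S : Pred (Monomial N) s) : Pred (Poly N) (c ⊔ ℓ₁ ⊔ s) where
      generator : ∀ {m} → S m → GeneratedAlgebra S (monomial m)
      const     : ∀ a → GeneratedAlgebra S (constant a)
      add       : ∀ {f g} → GeneratedAlgebra S f → GeneratedAlgebra S g → GeneratedAlgebra S (f +ᵖ g)
      mul       : ∀ {f g} → GeneratedAlgebra S f → GeneratedAlgebra S g → GeneratedAlgebra S (f *ᵖ g)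
      resp      : ∀ {f g} → f ≈ᵖ g → GeneratedAlgebra S f → GeneratedAlgebra S g

    -- The K-linear span of a set of monomials.
    data Span {s} (S : Pred (Monomial N) s) : Pred (Poly N) (c ⊔ ℓ₁ ⊔ s) where
      element : ∀ {m} → S m → Span S (monomial m)
      zero    : Span S []
      add     : ∀ {f g} → Span S f → Span S g → Span S (f +ᵖ g)
      scale   : ∀ a {f} → Span S f → Span S (constant a *ᵖ f)
      resp    : ∀ {f g} → f ≈ᵖ g → Span S f → Span S g

    module _ (_≺_ : Rel (Monomial N) 0ℓ) where

      -- The apartness from 0# is the constructive reading of being nonzero.
      IsInitialMonomial : Poly N → Pred (Monomial N) (ℓ₁ ⊔ ℓ₂)
      IsInitialMonomial f m = coeff f m # 0# × (∀ p → m ≺ p → coeff f p ≈ 0#)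

      InitialMonomials : ∀ {s} → Pred (Poly N) s → Pred (Monomial N) (c ⊔ ℓ₁ ⊔ ℓ₂ ⊔ s)
      InitialMonomials S m = ∃[ f ] S f × IsInitialMonomial f m

      InitialAlgebra : ∀ {a} → Pred (Poly N) a → Pred (Poly N) (c ⊔ ℓ₁ ⊔ ℓ₂ ⊔ a)
      InitialAlgebra A = Span (InitialMonomials A)

      IsSAGBIBasis : ∀ {a s} → Pred (Poly N) a → Pred (Poly N) s → Set (c ⊔ ℓ₁ ⊔ ℓ₂ ⊔ a ⊔ s)
      IsSAGBIBasis A S =
        S ⊆ A × (∀ f → GeneratedAlgebra (InitialMonomials S) f ⇔ InitialAlgebra A f)

      HasFiniteSAGBIBasis : ∀ {a} → Pred (Poly N) a → Set (c ⊔ ℓ₁ ⊔ ℓ₂ ⊔ a)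
      HasFiniteSAGBIBasis A = ∃[ L ] IsSAGBIBasis A (_∈ L)

  module _ {n : ℕ} (ε : VariableOrder n) where

    act : Permutation′ n → Poly (n C 2) → Poly (n C 2)
    act σ = map (map₂ (actᵐ ε σ))

    -- The ring of invariants, as a subset of K[x₀ , … , x_{N-1}], N = n C 2.
    Invariant : Pred (Poly (n C 2)) ℓ₁
    Invariant f = ∀ σ → act σ f ≈ᵖ f

{-# OPTIONS --safe #-}
module Submission where

open import Defs
open import Algebra.Apartness.Bundles using (HeytingField)
open import Data.Nat.Base using (ℕ; _≤_)
open import Data.Product.Base using (_×_)
open import Relation.Nullary using (¬_)

open import Algebra.Apartness.Bundles using (HeytingCommutativeRing)
import Algebra.Apartness.Properties.HeytingCommutativeRing as HeytingCommutativeRingProperties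
open import Algebra.Bundles using (CommutativeRing)
import Algebra.Properties.CommutativeMonoid.Sum as CommutativeMonoidSum
import Algebra.Properties.CommutativeSemigroup as CommutativeSemigroupProperties
open import Data.Empty using (⊥; ⊥-elim; ⊥-elim-irr)
open import Data.Fin.Base as Fin using (Fin; toℕ; fromℕ<; punchIn)
open import Data.Fin.Patterns using (0F; 1F; 2F; 3F)
open import Data.Fin.Permutation as Perm
  using (Permutation′; _⟨$⟩ʳ_; _⟨$⟩ˡ_; flip; _∘ₚ_; transpose; inverseˡ; inverseʳ)
import Data.Fin.Properties as Fin
open import Data.List.Base as List using (List; []; _∷_; _++_)
open import Data.List.Membership.DecPropositional using (_∈?_)
open import Data.List.Membership.Propositional using (_∈_; find; lose)
open import Data.List.Membership.Propositional.Properties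
  using (∈-++⁻; ∈-concat⁺′; ∈-cartesianProductWith⁺; ∈-cartesianProductWith⁻; ∈-allFin;
         ∈-map⁺; ∈-map⁻; ∈-deduplicate⁺; ∈-deduplicate⁻)
import Data.List.Properties as List
import Data.List.Relation.Unary.All as All
open import Data.List.Relation.Unary.AllPairs using (_∷_)
open import Data.List.Relation.Unary.Any as Any using (here; there)
open import Data.List.Relation.Unary.Unique.DecPropositional.Properties using (deduplicate-!)
open import Data.List.Relation.Unary.Unique.Propositional using (Unique)
import Data.List.Relation.Unary.Unique.Propositional.Properties as Unique
open import Data.Nat.Base as ℕ using (zero; suc; _+_; _*_; _<_; z≤n; s≤s)
open import Data.Nat.Combinatorics using (_C_)
import Data.Nat.Properties as ℕ
open import Data.Product.Base using (Σ-syntax; ∃-syntax; _,_; proj₁; proj₂)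
open import Data.Sum.Base using (_⊎_; inj₁; inj₂; [_,_]′; swap)
open import Data.Vec.Base as Vec using (Vec; []; _∷_; lookup; tabulate; zipWith; replicate)
import Data.Vec.Properties as Vec
import Data.Vec.Relation.Binary.Lex.Strict as Lex
open import Function.Base using (_∘_)
open import Function.Bundles using (Inverse; Injection; Equivalence; mk↔ₛ′)
open import Function.Properties.Inverse using (↔⇒↣)
open import Level using (0ℓ)
open import Relation.Binary.Core using (Rel)
open import Relation.Binary.Definitions using (DecidableEquality; tri<; tri≈; tri>)
open import Relation.Binary.PropositionalEquality
open import Relation.Nullary.Decidable using (Dec; yes; no; map′; _×-dec_; _⊎-dec_)
open import Relation.Unary using (Pred)

-- The initial monomials of invariants are exactly the monomials that are
-- maximal in their orbit, so a finite SAGBI basis would make the monoid of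
-- these maxima finitely generated, hence closed under limits: if v + k a is
-- maximal for all k, then so is a.  Maximality of v survives any strictly
-- monotone map of the exponents, so v + k θ(v) is maximal for every monotone
-- θ, and θ(v) would be maximal too.  This fails for two exponent vectors with
-- the same image under θ, the set of edges adjacent to an edge b, but whose
-- extreme exponent is at b in one case and at another edge of that set in the
-- other: the first variable would play two inequivalent roles in one graph.
-- Grading an order by degree does not change the maxima, and RevLex is Lex
-- with both the variables and the comparison reversed.

private
  variable
    n N : ℕ

-- Edges and the action of permutations on them

edge-ext : (e e′ : Edge n) → lo e ∈ᵉ e′ → hi e ∈ᵉ e′ → e ≡ e′
edge-ext (edge _ _ i<j) (edge _ _ _)   (inj₁ refl) (inj₁ refl) = ⊥-elim-irr (Fin.<-irrefl refl i<j)
edge-ext (edge _ _ _)   (edge _ _ _)   (inj₁ refl) (inj₂ refl) = refl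
edge-ext (edge _ _ i<j) (edge _ _ k<l) (inj₂ refl) (inj₁ refl) = ⊥-elim-irr (Fin.<-asym i<j k<l)
edge-ext (edge _ _ i<j) (edge _ _ _)   (inj₂ refl) (inj₂ refl) = ⊥-elim-irr (Fin.<-irrefl refl i<j)

-- A two-element set inside another equals it. Identities between edges are proved through their
-- vertices, so the order in which `⟪_,_⟫` stores the endpoints need not be followed.
⊆⇒≡ : (e e′ : Edge n) → (∀ v → v ∈ᵉ e → v ∈ᵉ e′) → e ≡ e′
⊆⇒≡ e e′ e⊆e′ = edge-ext e e′ (e⊆e′ _ (inj₁ refl)) (e⊆e′ _ (inj₂ refl))

_≟ᵉ_ : DecidableEquality (Edge n)
edge i j _ ≟ᵉ edge k l _ = map′ (λ where (refl , refl) → refl) (λ where refl → refl , refl)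
  (i Fin.≟ k ×-dec j Fin.≟ l)

adjacent? : (e e′ : Edge n) → Dec (Adjacent e e′)
adjacent? e e′ = Fin.any? λ v → (v ∈ᵉ? e) ×-dec (v ∈ᵉ? e′)
  where
  _∈ᵉ?_ : ∀ v e → Dec (v ∈ᵉ e)
  v ∈ᵉ? e = v Fin.≟ lo e ⊎-dec v Fin.≟ hi e

∈-⟪⟫⁺ : (i j : Fin n) {v : Fin n} .(i≢j : i ≢ j) → v ≡ i ⊎ v ≡ j → v ∈ᵉ ⟪ i , j ⟫ i≢j
∈-⟪⟫⁺ i j i≢j v∈ with Fin.<-cmp i j | v∈
... | tri< _ _ _   | v∈       = v∈
... | tri≈ _ i≡j _ | _        = ⊥-elim-irr (i≢j i≡j)
... | tri> _ _ _   | inj₁ v≡i = inj₂ v≡i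
... | tri> _ _ _   | inj₂ v≡j = inj₁ v≡j

∈-⟪⟫⁻ : (i j : Fin n) {v : Fin n} .(i≢j : i ≢ j) → v ∈ᵉ ⟪ i , j ⟫ i≢j → v ≡ i ⊎ v ≡ j
∈-⟪⟫⁻ i j i≢j v∈ with Fin.<-cmp i j | v∈
... | tri< _ _ _   | v∈       = v∈
... | tri≈ _ i≡j _ | _        = ⊥-elim-irr (i≢j i≡j)
... | tri> _ _ _   | inj₁ v≡j = inj₂ v≡j
... | tri> _ _ _   | inj₂ v≡i = inj₁ v≡i

∈-·ᵉ⁺ : (σ : Permutation′ n) (e : Edge n) {v : Fin n} → v ∈ᵉ e → (σ ⟨$⟩ʳ v) ∈ᵉ (σ ·ᵉ e)
∈-·ᵉ⁺ σ (edge i j _) (inj₁ refl) = ∈-⟪⟫⁺ (σ ⟨$⟩ʳ i) (σ ⟨$⟩ʳ j) _ (inj₁ refl)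
∈-·ᵉ⁺ σ (edge i j _) (inj₂ refl) = ∈-⟪⟫⁺ (σ ⟨$⟩ʳ i) (σ ⟨$⟩ʳ j) _ (inj₂ refl)

∈-·ᵉ⁻ : (σ : Permutation′ n) (e : Edge n) {v : Fin n} → v ∈ᵉ (σ ·ᵉ e) → ∃[ u ] u ∈ᵉ e × v ≡ σ ⟨$⟩ʳ u
∈-·ᵉ⁻ σ (edge i j i<j) v∈ with ∈-⟪⟫⁻ (σ ⟨$⟩ʳ i) (σ ⟨$⟩ʳ j)
  (λ σi≡σj → Fin.<⇒≢ i<j (Injection.injective (↔⇒↣ σ) σi≡σj)) v∈
... | inj₁ v≡σi = i , inj₁ refl , v≡σi
... | inj₂ v≡σj = j , inj₂ refl , v≡σj

·ᵉ-cong : (σ τ : Permutation′ n) → σ Perm.≈ τ → ∀ e → σ ·ᵉ e ≡ τ ·ᵉ e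
·ᵉ-cong σ τ σ≈τ e = ⊆⇒≡ _ _ λ v v∈ →
  let u , u∈e , v≡σu = ∈-·ᵉ⁻ σ e v∈ in
  subst (_∈ᵉ (τ ·ᵉ e)) (sym (trans v≡σu (σ≈τ u))) (∈-·ᵉ⁺ τ e u∈e)

·ᵉ-∘ : (σ τ : Permutation′ n) → ∀ e → (σ ∘ₚ τ) ·ᵉ e ≡ τ ·ᵉ (σ ·ᵉ e)
·ᵉ-∘ σ τ e = ⊆⇒≡ _ _ λ v v∈ →
  let u , u∈e , v≡τσu = ∈-·ᵉ⁻ (σ ∘ₚ τ) e v∈ in
  subst (_∈ᵉ (τ ·ᵉ (σ ·ᵉ e))) (sym v≡τσu) (∈-·ᵉ⁺ τ (σ ·ᵉ e) (∈-·ᵉ⁺ σ e u∈e))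

·ᵉ-id : (e : Edge n) → Perm.id ·ᵉ e ≡ e
·ᵉ-id e = sym (⊆⇒≡ e _ λ v → ∈-·ᵉ⁺ Perm.id e)

·ᵉ-flipˡ : (σ : Permutation′ n) → ∀ e → flip σ ·ᵉ (σ ·ᵉ e) ≡ e
·ᵉ-flipˡ σ e = trans (sym (·ᵉ-∘ σ (flip σ) e))
  (trans (·ᵉ-cong (σ ∘ₚ flip σ) Perm.id (λ _ → inverseˡ σ) e) (·ᵉ-id e))

·ᵉ-flipʳ : (σ : Permutation′ n) → ∀ e → σ ·ᵉ (flip σ ·ᵉ e) ≡ e
·ᵉ-flipʳ σ = ·ᵉ-flipˡ (flip σ)

Adjacent-·ᵉ : (σ : Permutation′ n) (e e′ : Edge n) → Adjacent e e′ → Adjacent (σ ·ᵉ e) (σ ·ᵉ e′)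
Adjacent-·ᵉ σ e e′ (v , v∈e , v∈e′) = σ ⟨$⟩ʳ v , ∈-·ᵉ⁺ σ e v∈e , ∈-·ᵉ⁺ σ e′ v∈e′

transpose-hit : (i j : Fin n) → transpose i j ⟨$⟩ʳ i ≡ j
transpose-hit i j with i Fin.≟ i
... | yes _  = refl
... | no i≢i = ⊥-elim (i≢i refl)

transpose-miss : (i j : Fin n) {k : Fin n} → k ≢ i → k ≢ j → transpose i j ⟨$⟩ʳ k ≡ k
transpose-miss i j {k} k≢i k≢j with k Fin.≟ i
... | yes k≡i = ⊥-elim (k≢i k≡i)
... | no _ with k Fin.≟ j
...   | yes k≡j = ⊥-elim (k≢j k≡j)
...   | no _    = refl

lo≢hi : (e : Edge n) → lo e ≢ hi e
lo≢hi (edge _ _ i<j) refl = ⊥-elim-irr (Fin.<-irrefl refl i<j)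

·ᵉ-transitive : (e e′ : Edge n) → ∃[ σ ] σ ·ᵉ e ≡ e′
·ᵉ-transitive {n} e e′ = σ , sym (edge-ext e′ _
    (subst (_∈ᵉ (σ ·ᵉ e)) σlo≡ (∈-·ᵉ⁺ σ e (inj₁ refl)))
    (subst (_∈ᵉ (σ ·ᵉ e)) (transpose-hit h (hi e′)) (∈-·ᵉ⁺ σ e (inj₂ refl))))
  where
  τ : Permutation′ n
  τ = transpose (lo e) (lo e′)
  h : Fin n
  h = τ ⟨$⟩ʳ hi e
  -- The second transposition corrects the image `h` of `hi e` and fixes `lo e′`, which differs from
  -- both `h` and `hi e′`.
  σ : Permutation′ n
  σ = τ ∘ₚ transpose h (hi e′)
  lo′≢h : lo e′ ≢ h
  lo′≢h lo′≡h = lo≢hi e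
    (Injection.injective (↔⇒↣ τ) (trans (transpose-hit (lo e) (lo e′)) lo′≡h))
  σlo≡ : σ ⟨$⟩ʳ lo e ≡ lo e′
  σlo≡ = trans (cong (transpose h (hi e′) ⟨$⟩ʳ_) (transpose-hit (lo e) (lo e′)))
               (transpose-miss h (hi e′) lo′≢h (lo≢hi e′))


-- Enumeration of the permutations

permutations : ∀ n → List (Permutation′ n)
permutations zero    = Perm.id ∷ []
permutations (suc n) = List.cartesianProductWith (Perm.insert Fin.zero) (List.allFin (suc n)) (permutations n)

-- A permutation of `suc n` points amounts to the image of zero and the permutation left after
-- removing zero. Pointwise equality suffices because of `·-cong`.
permutations-complete : (σ : Permutation′ n) → ∃[ τ ] τ ∈ permutations n × τ Perm.≈ σ
permutations-complete {zero}  σ = Perm.id , here refl , λ ()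
permutations-complete {suc n} σ with permutations-complete (Perm.remove Fin.zero σ)
... | τ , τ∈ , τ≈ = Perm.insert Fin.zero (σ ⟨$⟩ʳ Fin.zero) τ
                  , ∈-cartesianProductWith⁺ (Perm.insert Fin.zero) (∈-allFin _) τ∈
                  , λ i → trans (insert-cong i) (Perm.insert-remove Fin.zero σ i)
  where
  insert-cong : Perm.insert Fin.zero (σ ⟨$⟩ʳ Fin.zero) τ
         Perm.≈ Perm.insert Fin.zero (σ ⟨$⟩ʳ Fin.zero) (Perm.remove Fin.zero σ)
  insert-cong Fin.zero    = refl
  insert-cong (Fin.suc i) = cong (punchIn (σ ⟨$⟩ʳ Fin.zero)) (τ≈ i)

lookup-ext : ∀ {a} {A : Set a} {xs ys : Vec A N} → (∀ i → lookup xs i ≡ lookup ys i) → xs ≡ ys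
lookup-ext {xs = xs} {ys} xs≗ys =
  trans (sym (Vec.tabulate∘lookup xs)) (trans (Vec.tabulate-cong xs≗ys) (Vec.tabulate∘lookup ys))

-- The action on monomials and its orbits

module _ {n : ℕ} (ε : VariableOrder n) where

  infixr 8 _·_
  _·_ : Permutation′ n → Monomial (n C 2) → Monomial (n C 2)
  _·_ = actᵐ ε

  lookup-· : ∀ σ m k → lookup (σ · m) k ≡ lookup m (indexOf ε (flip σ ·ᵉ edgeOf ε k))
  lookup-· σ m = Vec.lookup∘tabulate _

  ·-cong : ∀ σ τ → σ Perm.≈ τ → ∀ m → σ · m ≡ τ · m
  ·-cong σ τ σ≈τ m = Vec.tabulate-cong λ k →
    cong (lookup m ∘ indexOf ε) (·ᵉ-cong (flip σ) (flip τ) flip-cong (edgeOf ε k))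
    where
    flip-cong : flip σ Perm.≈ flip τ
    flip-cong i = trans (sym (inverseˡ τ)) (cong (τ ⟨$⟩ˡ_) (trans (sym (σ≈τ _)) (inverseʳ σ)))

  -- `_∘ₚ_` applies its left argument first, so this is the law of a left action.
  ·-∘ : ∀ σ τ m → (σ ∘ₚ τ) · m ≡ τ · σ · m
  ·-∘ σ τ m = Vec.tabulate-cong λ k → sym (trans (lookup-· σ m _)
    (cong (lookup m ∘ indexOf ε)
      (trans (cong (flip σ ·ᵉ_) (Inverse.strictlyInverseˡ ε _))
             (sym (·ᵉ-∘ (flip τ) (flip σ) (edgeOf ε k))))))

  ·-id : ∀ m → Perm.id · m ≡ m
  ·-id m = trans (Vec.tabulate-cong λ k →
      cong (lookup m) (trans (cong (indexOf ε) (·ᵉ-id (edgeOf ε k))) (Inverse.strictlyInverseʳ ε k)))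
    (Vec.tabulate∘lookup m)

  ·-flipˡ : ∀ σ m → flip σ · σ · m ≡ m
  ·-flipˡ σ m = trans (sym (·-∘ σ (flip σ) m))
    (trans (·-cong (σ ∘ₚ flip σ) Perm.id (λ _ → inverseˡ σ) m) (·-id m))

  ·-flipʳ : ∀ σ m → σ · flip σ · m ≡ m
  ·-flipʳ σ = ·-flipˡ (flip σ)

  ·-map : ∀ σ (φ : ℕ → ℕ) m → σ · Vec.map φ m ≡ Vec.map φ (σ · m)
  ·-map σ φ m = lookup-ext λ k → trans (lookup-· σ (Vec.map φ m) k)
    (trans (Vec.lookup-map _ φ m)
      (sym (trans (Vec.lookup-map k φ (σ · m)) (cong φ (lookup-· σ m k)))))

  ·-zipWith : ∀ σ (f : ℕ → ℕ → ℕ) p q → σ · zipWith f p q ≡ zipWith f (σ · p) (σ · q)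
  ·-zipWith σ f p q = lookup-ext λ k → trans (lookup-· σ (zipWith f p q) k)
    (trans (Vec.lookup-zipWith f _ p q)
      (sym (trans (Vec.lookup-zipWith f k (σ · p) (σ · q)) (cong₂ f (lookup-· σ p k) (lookup-· σ q k)))))

  ·-replicate : ∀ σ x → σ · replicate _ x ≡ replicate _ x
  ·-replicate σ x = lookup-ext λ k → trans (lookup-· σ (replicate _ x) k)
    (trans (Vec.lookup-replicate (indexOf ε (flip σ ·ᵉ edgeOf ε k)) x) (sym (Vec.lookup-replicate k x)))

  -- Duplicates are removed so that the orbit sum gives each monomial the coefficient `1#` instead
  -- of the order of its stabiliser.
  orbit : Monomial (n C 2) → List (Monomial (n C 2))
  orbit m = List.deduplicate _≟ᵐ_ (List.map (_· m) (permutations n))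

  orbit-unique : ∀ m → Unique (orbit m)
  orbit-unique m = deduplicate-! _≟ᵐ_ _

  ∈-orbit⁺ : ∀ σ m → σ · m ∈ orbit m
  ∈-orbit⁺ σ m with permutations-complete σ
  ... | τ , τ∈ , τ≈σ = ∈-deduplicate⁺ _≟ᵐ_
    (subst (_∈ List.map (_· m) (permutations n)) (·-cong τ σ τ≈σ m) (∈-map⁺ (_· m) τ∈))

  ∈-orbit⁻ : ∀ {p} m → p ∈ orbit m → ∃[ σ ] p ≡ σ · m
  ∈-orbit⁻ m p∈ with ∈-map⁻ (_· m) (∈-deduplicate⁻ _≟ᵐ_ _ p∈)
  ... | σ , _ , p≡σm = σ , p≡σm

  -- The action reindexes the exponents by the permutation `π` of the variables, and a finite sum is
  -- invariant under reindexing.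
  degree-· : ∀ σ m → degree (σ · m) ≡ degree m
  degree-· σ m = trans (sum-tabulate (λ k → lookup m (π ⟨$⟩ʳ k)))
    (trans (sym (∑-permute (lookup m) π))
      (trans (sym (sum-tabulate (lookup m))) (cong degree (Vec.tabulate∘lookup m))))
    where
    open CommutativeMonoidSum ℕ.+-0-commutativeMonoid using (sum; ∑-permute)

    sum-tabulate : ∀ {N} (f : Fin N → ℕ) → degree (tabulate f) ≡ sum f
    sum-tabulate {zero}  f = refl
    sum-tabulate {suc N} f = cong (f Fin.zero +_) (sum-tabulate (f ∘ Fin.suc))

    π : Permutation′ (n C 2)
    π = mk↔ₛ′ (λ k → indexOf ε (flip σ ·ᵉ edgeOf ε k)) (λ k → indexOf ε (σ ·ᵉ edgeOf ε k))
      (conj (flip σ) σ (·ᵉ-flipˡ σ)) (conj σ (flip σ) (·ᵉ-flipʳ σ))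
      where
      conj : ∀ ρ τ → (∀ e → ρ ·ᵉ (τ ·ᵉ e) ≡ e) →
        ∀ k → indexOf ε (ρ ·ᵉ edgeOf ε (indexOf ε (τ ·ᵉ edgeOf ε k))) ≡ k
      conj ρ τ ρτ≡id k = trans (cong (indexOf ε)
          (trans (cong (ρ ·ᵉ_) (Inverse.strictlyInverseˡ ε _)) (ρτ≡id (edgeOf ε k))))
        (Inverse.strictlyInverseʳ ε k)

  Maximal : Rel (Monomial (n C 2)) 0ℓ → Monomial (n C 2) → Set
  Maximal _≺_ m = ∀ σ → ¬ (m ≺ (σ · m))

-- Lexicographic comparison and its additive certificates

-- Stated for functions, with the first position of disagreement as witness, so that exponents can
-- be read in any order of the variables.
_<ˡ_ : Rel (Fin N → ℕ) 0ℓ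
p <ˡ q = ∃[ k ] p k < q k × (∀ l → l Fin.< k → p l ≡ q l)

<ˡ-irrefl : {p q : Fin N → ℕ} → p ≗ q → ¬ (p <ˡ q)
<ˡ-irrefl p≗q (k , pk<qk , _) = ℕ.<⇒≢ pk<qk (p≗q k)

<ˡ-trans : {p q r : Fin N → ℕ} → p <ˡ q → q <ˡ r → p <ˡ r
<ˡ-trans {p = p} {q} {r} (k , pk<qk , p≗q) (l , ql<rl , q≗r) with Fin.<-cmp k l
... | tri< k<l _ _  = k , subst (p k <_) (q≗r k k<l) pk<qk
                    , λ i i<k → trans (p≗q i i<k) (q≗r i (ℕ.<-trans i<k k<l))
... | tri≈ _ refl _ = k , ℕ.<-trans pk<qk ql<rl , λ i i<k → trans (p≗q i i<k) (q≗r i i<k)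
... | tri> _ _ l<k  = l , subst (_< r l) (sym (p≗q l l<k)) ql<rl
                    , λ i i<l → trans (p≗q i (ℕ.<-trans i<l l<k)) (q≗r i i<l)

private
  <ˡ-cons : {p q : Fin (suc N) → ℕ} → p Fin.zero ≡ q Fin.zero → (p ∘ Fin.suc) <ˡ (q ∘ Fin.suc) → p <ˡ q
  <ˡ-cons p₀≡q₀ (k , pk<qk , p≗q) = Fin.suc k , pk<qk , λ where
    Fin.zero    _         → p₀≡q₀
    (Fin.suc l) (s≤s l<k) → p≗q l l<k

<ˡ-connex : (p q : Fin N → ℕ) → p ≗ q ⊎ p <ˡ q ⊎ q <ˡ p
<ˡ-connex {zero}  p q = inj₁ λ ()
<ˡ-connex {suc N} p q with ℕ.<-cmp (p Fin.zero) (q Fin.zero)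
... | tri< p₀<q₀ _ _ = inj₂ (inj₁ (Fin.zero , p₀<q₀ , λ _ ()))
... | tri> _ _ q₀<p₀ = inj₂ (inj₂ (Fin.zero , q₀<p₀ , λ _ ()))
... | tri≈ _ p₀≡q₀ _ with <ˡ-connex (p ∘ Fin.suc) (q ∘ Fin.suc)
...   | inj₁ p≗q        = inj₁ λ { Fin.zero → p₀≡q₀ ; (Fin.suc k) → p≗q k }
...   | inj₂ (inj₁ p<q) = inj₂ (inj₁ (<ˡ-cons p₀≡q₀ p<q))
...   | inj₂ (inj₂ q<p) = inj₂ (inj₂ (<ˡ-cons (sym p₀≡q₀) q<p))

Lex⇒<ˡ : {p q : Monomial N} → Lex p q → lookup p <ˡ lookup q
Lex⇒<ˡ (Lex.this x<y _)     = Fin.zero , x<y , λ _ ()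
Lex⇒<ˡ (Lex.next refl p<q) = <ˡ-cons refl (Lex⇒<ˡ p<q)

<ˡ⇒Lex : {p q : Monomial N} → lookup p <ˡ lookup q → Lex p q
<ˡ⇒Lex {p = _ ∷ _} {_ ∷ _} (Fin.zero  , x<y   , _)   = Lex.this x<y refl
<ˡ⇒Lex {p = _ ∷ _} {_ ∷ _} (Fin.suc k , pk<qk , p≗q) =
  Lex.next (p≗q Fin.zero (s≤s z≤n)) (<ˡ⇒Lex (k , pk<qk , λ l l<k → p≗q (Fin.suc l) (s≤s l<k)))

-- An additive certificate for P being lexicographically at most Q: for a
-- single pair bounded by R, c (suc j) is 1 if P and Q differ at or before j
-- and 0 otherwise; for a sum of such pairs it counts them.
record Certified {N : ℕ} (R : ℕ) (P Q : Fin N → ℕ) : Set where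
  constructor certificate
  field
    c     : ℕ → ℕ
    c₀≡0  : c 0 ≡ 0
    bound : ∀ j → P j + c (suc (toℕ j)) ≤ Q j + suc R * c (toℕ j)

open Certified

certified-resp : ∀ {R} {P P′ Q Q′ : Fin N → ℕ} → P ≗ P′ → Q ≗ Q′ → Certified R P Q → Certified R P′ Q′
certified-resp {R = R} P≗ Q≗ (certificate c c₀ h) = certificate c c₀ λ j →
  subst₂ (λ x y → x + c (suc (toℕ j)) ≤ y + suc R * c (toℕ j)) (P≗ j) (Q≗ j) (h j)

certified-refl : ∀ {R} {P Q : Fin N → ℕ} → P ≗ Q → Certified R P Q
certified-refl P≗Q = certificate (λ _ → 0) refl λ j → ℕ.+-mono-≤ (ℕ.≤-reflexive (P≗Q j)) z≤n

-- The bound is linear in `P`, `Q` and `c` together. The lexicographic condition itself is not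
-- linear, which is the reason for certificates.
certified-+ : ∀ {R} {P Q P′ Q′ : Fin N → ℕ} → Certified R P Q → Certified R P′ Q′ →
  Certified R (λ i → P i + P′ i) (λ i → Q i + Q′ i)
certified-+ {R = R} {P} {Q} {P′} {Q′} (certificate c c₀ h) (certificate c′ c′₀ h′) =
  certificate (λ i → c i + c′ i) (cong₂ _+_ c₀ c′₀) λ j → let i = toℕ j in begin
    P j + P′ j + (c (suc i) + c′ (suc i))               ≡⟨ interchange (P j) _ _ _ ⟩
    (P j + c (suc i)) + (P′ j + c′ (suc i))             ≤⟨ ℕ.+-mono-≤ (h j) (h′ j) ⟩
    (Q j + suc R * c i) + (Q′ j + suc R * c′ i)         ≡⟨ interchange (Q j) _ _ _ ⟩
    Q j + Q′ j + (suc R * c i + suc R * c′ i)           ≡⟨ cong (Q j + Q′ j +_) (ℕ.*-distribˡ-+ (suc R) (c i) _) ⟨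
    Q j + Q′ j + suc R * (c i + c′ i)                   ∎
  where
  open ℕ.≤-Reasoning
  open CommutativeSemigroupProperties ℕ.+-commutativeSemigroup using (interchange)

-- Before `k` the entries agree and `d` vanishes; at `k` the strict increase pays for the step of
-- `d`; after `k` the term `suc R` outweighs `P j + 1`, as `P j` is at most `R`.
certified-< : ∀ {R} {P Q : Fin N → ℕ} → (∀ i → P i ≤ R) → P <ˡ Q → Certified R P Q
certified-< {R = R} {P} {Q} P≤R (k , Pk<Qk , P≗Q) = certificate d (≤⇒d≡0 z≤n) d-bound
  where
  d : ℕ → ℕ
  -- The indicator of `toℕ k < i`.
  d i = 1 ℕ.⊓ (i ℕ.∸ toℕ k)

  ≤⇒d≡0 : ∀ {i} → i ≤ toℕ k → d i ≡ 0
  ≤⇒d≡0 i≤k = cong (1 ℕ.⊓_) (ℕ.m≤n⇒m∸n≡0 i≤k)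

  d-bound : ∀ j → P j + d (suc (toℕ j)) ≤ Q j + suc R * d (toℕ j)
  d-bound j with Fin.<-cmp j k
  ... | tri< j<k _ _  rewrite ≤⇒d≡0 j<k | P≗Q j j<k = ℕ.+-monoʳ-≤ (Q j) z≤n
  ... | tri≈ _ refl _ = ℕ.≤-trans (ℕ.+-monoʳ-≤ (P j) (ℕ.m⊓n≤m 1 _))
    (ℕ.≤-trans (ℕ.≤-reflexive (ℕ.+-comm (P j) 1)) (ℕ.≤-trans Pk<Qk (ℕ.m≤m+n (Q j) _)))
  ... | tri> _ _ k<j  = begin
    P j + d (suc (toℕ j))         ≤⟨ ℕ.+-mono-≤ (P≤R j) (ℕ.m⊓n≤m 1 _) ⟩
    R + 1                         ≡⟨ ℕ.+-comm R 1 ⟩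
    suc R                         ≡⟨ ℕ.*-identityʳ (suc R) ⟨
    suc R * 1                     ≡⟨ cong (suc R *_) (ℕ.m≤n⇒m⊓n≡m (ℕ.m<n⇒0<n∸m k<j)) ⟨
    suc R * d (toℕ j)             ≤⟨ ℕ.m≤n+m _ (Q j) ⟩
    Q j + suc R * d (toℕ j)       ∎
    where open ℕ.≤-Reasoning

-- If b and a first differ at j, the counts up to j are bounded independently
-- of k by induction on the position, so a deficit k (a j - b j) at j cannot
-- be compensated.
certified-limit : ∀ {R} {p q a b : Fin N → ℕ} →
  (∀ k → Certified R (λ i → p i + k * a i) (λ i → q i + k * b i)) → ¬ (b <ˡ a)
certified-limit {N = N} {R} {p} {q} {a} {b} cert (j , bj<aj , b≗a) = ℕ.<-irrefl refl absurd
  where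
  open ℕ.≤-Reasoning
  open CommutativeSemigroupProperties ℕ.+-commutativeSemigroup using (xy∙z≈xz∙y)

  bounded : ∀ i → i ≤ toℕ j → ∃[ B ] ∀ k → c (cert k) i ≤ B
  bounded zero    _   = 0 , λ k → ℕ.≤-reflexive (c₀≡0 (cert k))
  bounded (suc i) i<j with bounded i (ℕ.<⇒≤ i<j)
  -- As `b` and `a` agree at `l`, the term `k * a l` cancels and leaves a bound free of `k`.
  ... | B , ck≤B = q l + suc R * B , λ k → ℕ.+-cancelˡ-≤ (k * a l) _ _ (begin
      k * a l + c (cert k) (suc i)                   ≤⟨ ℕ.+-monoˡ-≤ _ (ℕ.m≤n+m (k * a l) (p l)) ⟩
      p l + k * a l + c (cert k) (suc i)             ≡⟨ cong (λ i → p l + k * a l + c (cert k) (suc i)) l≡i ⟨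
      p l + k * a l + c (cert k) (suc (toℕ l))       ≤⟨ bound (cert k) l ⟩
      q l + k * b l + suc R * c (cert k) (toℕ l)     ≡⟨ cong₂ (λ x i → q l + k * x + suc R * c (cert k) i) bl≡al l≡i ⟩
      q l + k * a l + suc R * c (cert k) i           ≤⟨ ℕ.+-monoʳ-≤ (q l + k * a l) (ℕ.*-monoʳ-≤ (suc R) (ck≤B k)) ⟩
      q l + k * a l + suc R * B               ≡⟨ cong (_+ suc R * B) (ℕ.+-comm (q l) (k * a l)) ⟩
      k * a l + q l + suc R * B               ≡⟨ ℕ.+-assoc (k * a l) (q l) _ ⟩
      k * a l + (q l + suc R * B)             ∎)
    where
    i<N : i < N
    i<N = ℕ.<-trans i<j (Fin.toℕ<n j)
    l : Fin N
    l = fromℕ< i<N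
    l≡i : toℕ l ≡ i
    l≡i = Fin.toℕ-fromℕ< i<N
    bl≡al : b l ≡ a l
    bl≡al = b≗a l (subst (_< toℕ j) (sym l≡i) i<j)

  B : ℕ
  B = proj₁ (bounded (toℕ j) ℕ.≤-refl)
  -- The certificate at `j` limits `k` times the difference of `a j` and `b j` to `q j + suc R * B`.
  -- The difference is at least 1, so one more than this limit is already too large.
  k : ℕ
  k = suc (q j + suc R * B)

  absurd : k ≤ q j + suc R * B
  absurd = ℕ.+-cancelʳ-≤ (k * b j) _ _ (begin
    k + k * b j                                   ≡⟨ ℕ.*-suc k (b j) ⟨
    k * suc (b j)                                 ≤⟨ ℕ.*-monoʳ-≤ k bj<aj ⟩
    k * a j                                       ≤⟨ ℕ.m≤n+m (k * a j) (p j) ⟩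
    p j + k * a j                                 ≤⟨ ℕ.m≤m+n _ (c (cert k) (suc (toℕ j))) ⟩
    p j + k * a j + c (cert k) (suc (toℕ j))             ≤⟨ bound (cert k) j ⟩
    q j + k * b j + suc R * c (cert k) (toℕ j)           ≤⟨ ℕ.+-monoʳ-≤ (q j + k * b j)
                                                     (ℕ.*-monoʳ-≤ (suc R) (proj₂ (bounded (toℕ j) ℕ.≤-refl) k)) ⟩
    q j + k * b j + suc R * B                     ≡⟨ xy∙z≈xz∙y (q j) (k * b j) _ ⟩
    q j + suc R * B + k * b j                     ∎)

-- Orders of lexicographic type

Bounded : ℕ → Monomial N → Set
Bounded R m = ∀ k → lookup m k ≤ R

infixl 6 _⊕_
_⊕_ : Monomial N → Monomial N → Monomial N
_⊕_ = zipWith _+_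

infixr 7 _⊛_
_⊛_ : ℕ → Monomial N → Monomial N
k ⊛ m = Vec.map (k *_) m

-- Dominated R extends the order on R-bounded monomials to an additively
-- closed relation that is still compatible with the order in the limit.
record LexLike {N : ℕ} (_⊏_ : Rel (Monomial N) 0ℓ) : Set₁ where
  field
    ⊏-irrefl : ∀ {p} → ¬ (p ⊏ p)
    ⊏-trans  : ∀ {p q r} → p ⊏ q → q ⊏ r → p ⊏ r
    ⊏-connex : ∀ p q → p ≡ q ⊎ p ⊏ q ⊎ q ⊏ p
    ⊏-map    : ∀ {φ} → (∀ {x y} → x < y → φ x < φ y) → ∀ {p q} → p ⊏ q → Vec.map φ p ⊏ Vec.map φ q

    Dominated       : ℕ → Rel (Monomial N) 0ℓ
    dominated-refl  : ∀ {R p} → Dominated R p p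
    dominated-<     : ∀ {R p q} → Bounded R p → Bounded R q → p ⊏ q → Dominated R p q
    dominated-⊕     : ∀ {R p q p′ q′} → Dominated R p q → Dominated R p′ q′ → Dominated R (p ⊕ p′) (q ⊕ q′)
    dominated-limit : ∀ {R p q a b} → (∀ k → Dominated R (p ⊕ k ⊛ a) (q ⊕ k ⊛ b)) → ¬ (b ⊏ a)

-- The axioms are self-dual: `dominated-<` bounds both monomials, so reversing the order just swaps
-- the arguments of `Dominated`.
flip-lexLike : {_⊏_ : Rel (Monomial N) 0ℓ} → LexLike _⊏_ → LexLike (λ p q → q ⊏ p)
flip-lexLike L = record
  { ⊏-irrefl        = ⊏-irrefl
  ; ⊏-trans         = λ p⊐q q⊐r → ⊏-trans q⊐r p⊐q
  ; ⊏-connex        = λ p q → [ (λ p≡q → inj₁ p≡q) , (λ c → inj₂ (swap c)) ]′ (⊏-connex p q)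
  ; ⊏-map           = λ φ-mono → ⊏-map φ-mono
  ; Dominated       = λ R p q → Dominated R q p
  ; dominated-refl  = dominated-refl
  ; dominated-<     = λ p≤R q≤R → dominated-< q≤R p≤R
  ; dominated-⊕     = dominated-⊕
  ; dominated-limit = dominated-limit
  }
  where open LexLike L

module _ (s : Permutation′ N) where

  scan : Monomial N → Fin N → ℕ
  scan m i = lookup m (s ⟨$⟩ʳ i)

  -- `s` lists the variables in the order of inspection: the identity gives `Lex`, and the reversal
  -- gives the converse of `RevLex`.
  LexAlong : Rel (Monomial N) 0ℓ
  LexAlong p q = scan p <ˡ scan q

  private
    scan-injective : ∀ {p q} → scan p ≗ scan q → p ≡ q
    scan-injective {p} {q} sp≗sq = lookup-ext λ i →
      subst (λ k → lookup p k ≡ lookup q k) (inverseʳ s) (sp≗sq (s ⟨$⟩ˡ i))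

    scan-map : ∀ φ m i → scan (Vec.map φ m) i ≡ φ (scan m i)
    scan-map φ m i = Vec.lookup-map (s ⟨$⟩ʳ i) φ m

    scan-⊕ : ∀ p q i → scan p i + scan q i ≡ scan (p ⊕ q) i
    scan-⊕ p q i = sym (Vec.lookup-zipWith _+_ (s ⟨$⟩ʳ i) p q)

  lexAlong-lexLike : LexLike LexAlong
  lexAlong-lexLike = record
    { ⊏-irrefl        = <ˡ-irrefl λ _ → refl
    ; ⊏-trans         = <ˡ-trans
    ; ⊏-connex        = λ p q → [ (λ sp≗sq → inj₁ (scan-injective sp≗sq)) , inj₂ ]′ (<ˡ-connex (scan p) (scan q))
    ; ⊏-map           = λ { {φ} φ-mono {p} {q} (k , pk<qk , p≗q) →
        k , subst₂ _<_ (sym (scan-map φ p k)) (sym (scan-map φ q k)) (φ-mono pk<qk)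
          , λ l l<k → trans (scan-map φ p l) (trans (cong φ (p≗q l l<k)) (sym (scan-map φ q l))) }
    ; Dominated       = λ R p q → Certified R (scan p) (scan q)
    ; dominated-refl  = certified-refl λ _ → refl
    ; dominated-<     = λ p≤R _ → certified-< λ i → p≤R (s ⟨$⟩ʳ i)
    ; dominated-⊕     = λ {R} {p} {q} {p′} {q′} c c′ →
        certified-resp (scan-⊕ p p′) (scan-⊕ q q′) (certified-+ c c′)
    ; dominated-limit = λ {R} {p} {q} {a} {b} cert → certified-limit λ k →
        certified-resp (scan-⊕⊛ p a k) (scan-⊕⊛ q b k) (cert k)
    }
    where
    scan-⊕⊛ : ∀ p a k i → scan (p ⊕ k ⊛ a) i ≡ scan p i + k * scan a i
    scan-⊕⊛ p a k i = trans (sym (scan-⊕ p (k ⊛ a) i)) (cong (scan p i +_) (scan-map (k *_) a i))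

-- The monoid of orbit maxima

data Generated {N s} (S : Pred (Monomial N) s) : Pred (Monomial N) s where
  unit : Generated S (replicate N 0)
  gen  : ∀ {m} → S m → Generated S m
  mul  : ∀ {p q} → Generated S p → Generated S q → Generated S (p ⊕ q)

generated-mono : ∀ {s t} {S : Pred (Monomial N) s} {T : Pred (Monomial N) t} →
  (∀ {m} → S m → T m) → ∀ {m} → Generated S m → Generated T m
generated-mono S⊆T unit      = unit
generated-mono S⊆T (gen m∈S) = gen (S⊆T m∈S)
generated-mono S⊆T (mul p q) = mul (generated-mono S⊆T p) (generated-mono S⊆T q)

module _ {n : ℕ} (ε : VariableOrder n) where

  -- Finite generation is encoded by a common bound on the exponents of the generators; only
  -- finitely many monomials satisfy such a bound.
  FinitelyGeneratedMaxima : Rel (Monomial (n C 2)) 0ℓ → Set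
  FinitelyGeneratedMaxima _≺_ =
    ∃[ R ] ∀ v → Maximal ε _≺_ v → Generated (λ m → Bounded R m × Maximal ε _≺_ m) v

  -- Maximality compares a monomial with its own translates only, so it suffices that the two
  -- relations agree on such pairs.
  finitelyGeneratedMaxima-resp : (_≺_ _⊏_ : Rel (Monomial (n C 2)) 0ℓ) →
    (∀ σ p → p ≺ actᵐ ε σ p → p ⊏ actᵐ ε σ p) → (∀ σ p → p ⊏ actᵐ ε σ p → p ≺ actᵐ ε σ p) →
    FinitelyGeneratedMaxima _≺_ → FinitelyGeneratedMaxima _⊏_
  finitelyGeneratedMaxima-resp _ _ ≺⇒⊏ ⊏⇒≺ (R , generated) = R , λ v v-max →
    generated-mono (λ {m} (m≤R , m-max) → m≤R , λ σ m⊏σm → m-max σ (⊏⇒≺ σ m m⊏σm))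
      (generated v λ σ v≺σv → v-max σ (≺⇒⊏ σ v v≺σv))

  module _ {_⊏_ : Rel (Monomial (n C 2)) 0ℓ} (L : LexLike _⊏_) where
    open LexLike L

    private
      infixr 8 _∙_
      _∙_ : Permutation′ n → Monomial (n C 2) → Monomial (n C 2)
      _∙_ = actᵐ ε

      Max : Monomial (n C 2) → Set
      Max = Maximal ε _⊏_

    maximum : ∀ x xs → ∃[ y ] y ∈ x ∷ xs × (∀ {z} → z ∈ x ∷ xs → ¬ (y ⊏ z))
    maximum x []        = x , here refl , λ { (here refl) → ⊏-irrefl }
    maximum x (x′ ∷ xs) with maximum x′ xs
    ... | y , y∈ , y-max with ⊏-connex x y
    ...   | inj₁ refl       = y , there y∈ , λ { (here refl) → ⊏-irrefl ; (there z∈) → y-max z∈ }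
    ...   | inj₂ (inj₁ x⊏y) = y , there y∈ , λ where
      (here refl) y⊏x → ⊏-irrefl (⊏-trans x⊏y y⊏x)
      (there z∈)      → y-max z∈
    ...   | inj₂ (inj₂ y⊏x) = x , here refl , λ where
      (here refl)    → ⊏-irrefl
      (there z∈) x⊏z → y-max z∈ (⊏-trans y⊏x x⊏z)

    orbit-maximum : ∀ m → ∃[ τ ] Max (τ ∙ m)
    -- `m` in front makes the list visibly nonempty; it is the translate of itself by `Perm.id`.
    orbit-maximum m with maximum m (orbit ε m)
    ... | y , y∈ , y-max with y∈orbit y∈
      where
      y∈orbit : ∀ {y} → y ∈ m ∷ orbit ε m → ∃[ τ ] y ≡ τ ∙ m
      y∈orbit (here refl) = Perm.id , sym (·-id ε m)
      y∈orbit (there y∈)  = ∈-orbit⁻ ε m y∈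
    ...   | τ , refl = τ , λ σ →
      y-max (there (subst (_∈ orbit ε m) (·-∘ ε τ σ m) (∈-orbit⁺ ε (τ ∘ₚ σ) m)))

    -- `τ ∙ μ` is the translate of `σ ∙ μ` by the inverse of `σ` followed by `τ`.
    maximal-≮ : ∀ {μ} σ τ → Max (σ ∙ μ) → ¬ ((σ ∙ μ) ⊏ (τ ∙ μ))
    maximal-≮ {μ} σ τ σμ-max σμ⊏τμ = σμ-max (flip σ ∘ₚ τ) (subst ((σ ∙ μ) ⊏_)
      (sym (trans (·-∘ ε (flip σ) τ (σ ∙ μ)) (cong (τ ∙_) (·-flipˡ ε σ μ)))) σμ⊏τμ)

    maximal-unique : ∀ {μ} σ τ → Max (σ ∙ μ) → Max (τ ∙ μ) → σ ∙ μ ≡ τ ∙ μ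
    maximal-unique {μ} σ τ σμ-max τμ-max with ⊏-connex (σ ∙ μ) (τ ∙ μ)
    ... | inj₁ σμ≡τμ        = σμ≡τμ
    ... | inj₂ (inj₁ σμ⊏τμ) = ⊥-elim (maximal-≮ {μ} σ τ σμ-max σμ⊏τμ)
    ... | inj₂ (inj₂ τμ⊏σμ) = ⊥-elim (maximal-≮ {μ} τ σ τμ-max τμ⊏σμ)

    -- By connexity each `σ ∙ v` equals `v` or lies below it. The action moves positions and `φ`
    -- changes values, so they commute, and `φ` preserves both alternatives.
    maximal-map : ∀ {φ} → (∀ {x y} → x < y → φ x < φ y) → ∀ {v} → Max v → Max (Vec.map φ v)
    maximal-map {φ} φ-mono {v} v-max σ φv⊏σφv with ⊏-connex v (σ ∙ v)
    ... | inj₁ v≡σv        = ⊏-irrefl (subst (Vec.map φ v ⊏_)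
      (trans (·-map ε σ φ v) (cong (Vec.map φ) (sym v≡σv))) φv⊏σφv)
    ... | inj₂ (inj₁ v⊏σv) = v-max σ v⊏σv
    ... | inj₂ (inj₂ σv⊏v) = ⊏-irrefl (⊏-trans φv⊏σφv
      (subst (_⊏ Vec.map φ v) (sym (·-map ε σ φ v)) (⊏-map φ-mono σv⊏v)))

    -- A bounded maximal generator dominates its translate, and domination is additive. The `R` of
    -- the generators serves every product, however large, which the passage to the limit requires.
    generated⇒dominated : ∀ {R v} σ → Generated (λ m → Bounded R m × Max m) v → Dominated R (σ ∙ v) v
    generated⇒dominated {R} σ unit =
      subst (λ p → Dominated R p (replicate _ 0)) (sym (·-replicate ε σ 0)) dominated-refl
    generated⇒dominated {R} σ (gen {m} (m≤R , m-max)) with ⊏-connex (σ ∙ m) m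
    ... | inj₁ σm≡m        = subst (λ p → Dominated R p m) (sym σm≡m) dominated-refl
    ... | inj₂ (inj₁ σm⊏m) = dominated-< (λ k → subst (_≤ R) (sym (lookup-· ε σ m k)) (m≤R _)) m≤R σm⊏m
    ... | inj₂ (inj₂ m⊏σm) = ⊥-elim (m-max σ m⊏σm)
    generated⇒dominated {R} σ (mul {p} {q} gp gq) =
      subst (λ m → Dominated R m (p ⊕ q)) (sym (·-zipWith ε σ _+_ p q))
        (dominated-⊕ (generated⇒dominated σ gp) (generated⇒dominated σ gq))

    maximal-map-weak : FinitelyGeneratedMaxima _⊏_ → ∀ {θ} → (∀ {x y} → x ≤ y → θ x ≤ θ y) →
      ∀ {v} → Max v → Max (Vec.map θ v)
    maximal-map-weak (R , generated) {θ} θ-mono {v} v-max σ θv⊏σθv =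
      dominated-limit dominated (subst (Vec.map θ v ⊏_) (·-map ε σ θ v) θv⊏σθv)
      where
      -- The summand `x` makes `φ k` strictly monotone although `θ` is only weakly so; in the limit
      -- over `k` the multiple of `θ` decides.
      φ : ℕ → ℕ → ℕ
      φ k x = x + k * θ x

      map-φ : ∀ k (m : Monomial (n C 2)) → Vec.map (φ k) m ≡ m ⊕ k ⊛ Vec.map θ m
      map-φ k m = lookup-ext λ i → trans (Vec.lookup-map i (φ k) m)
        (sym (trans (Vec.lookup-zipWith _+_ i m _)
          (cong (lookup m i +_) (trans (Vec.lookup-map i (k *_) (Vec.map θ m))
            (cong (k *_) (Vec.lookup-map i θ m))))))

      dominated : ∀ k → Dominated R ((σ ∙ v) ⊕ k ⊛ Vec.map θ (σ ∙ v)) (v ⊕ k ⊛ Vec.map θ v)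
      dominated k = subst₂ (Dominated R)
        (trans (·-map ε σ (φ k) v) (map-φ k (σ ∙ v))) (map-φ k v)
        (generated⇒dominated σ (generated (Vec.map (φ k) v)
          (maximal-map (λ x<y → ℕ.+-mono-<-≤ x<y (ℕ.*-monoʳ-≤ k (θ-mono (ℕ.<⇒≤ x<y)))) v-max)))

    -- Give one edge x adjacent to b the weight w₂, the remaining edges
    -- adjacent to b the weight w₁, and all others w₀.  In a maximal translate
    -- x sits at position k₀, whereas the translate of the set of edges
    -- adjacent to b is the same for x = a and x = b.
    maxima-not-finitelyGenerated :
      ∀ {_◁_ : Rel ℕ 0ℓ} {k₀} → (∀ p q → lookup p k₀ ◁ lookup q k₀ → p ⊏ q) →
      ∀ {θ : ℕ → ℕ} → (∀ {x y} → x ≤ y → θ x ≤ θ y) →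
      ∀ {w₀ w₁ w₂} → w₀ ◁ w₂ → w₁ ◁ w₂ → θ w₁ ≡ θ w₂ → θ w₀ ≢ θ w₁ →
      ∀ (a b c : Edge n) → Adjacent a b → Adjacent c b → ¬ Adjacent c a →
      ¬ FinitelyGeneratedMaxima _⊏_
    maxima-not-finitelyGenerated {_◁_} {k₀} first {θ} θ-mono {w₀} {w₁} {w₂} w₀◁w₂ w₁◁w₂ θw₁≡θw₂ θw₀≢θw₁
      a b c a~b c~b c≁a fg =
      conclude (orbit-maximum (weighted b)) (orbit-maximum (weighted a))
      where
      e₀ : Edge n
      e₀ = edgeOf ε k₀

      weight : Edge n → Edge n → ℕ
      weight x e with e ≟ᵉ x | adjacent? e b
      ... | yes _ | _     = w₂
      ... | no _  | yes _ = w₁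
      ... | no _  | no _  = w₀

      weight-≡ : ∀ x → weight x x ≡ w₂
      weight-≡ x with x ≟ᵉ x | adjacent? x b
      ... | yes _  | _ = refl
      ... | no x≢x | _ = ⊥-elim (x≢x refl)

      weight-≢ : ∀ {x e} → e ≢ x → weight x e ◁ w₂
      weight-≢ {x} {e} e≢x with e ≟ᵉ x | adjacent? e b
      ... | yes e≡x | _     = ⊥-elim (e≢x e≡x)
      ... | no _    | yes _ = w₁◁w₂
      ... | no _    | no _  = w₀◁w₂

      θ-weight-~ : ∀ x {e} → Adjacent e b → θ (weight x e) ≡ θ w₁
      θ-weight-~ x {e} e~b with e ≟ᵉ x | adjacent? e b
      ... | yes _ | _      = sym θw₁≡θw₂
      ... | no _  | yes _  = refl
      ... | no _  | no e≁b = ⊥-elim (e≁b e~b)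

      θ-weight-≁ : ∀ {x e} → Adjacent x b → ¬ Adjacent e b → θ (weight x e) ≡ θ w₀
      θ-weight-≁ {x} {e} x~b e≁b with e ≟ᵉ x | adjacent? e b
      ... | yes refl | _       = ⊥-elim (e≁b x~b)
      ... | no _     | yes e~b = ⊥-elim (e≁b e~b)
      ... | no _     | no _    = refl

      weighted : Edge n → Monomial (n C 2)
      weighted x = tabulate (weight x ∘ edgeOf ε)

      lookup-weighted : ∀ x ρ k → lookup (ρ ∙ weighted x) k ≡ weight x (flip ρ ·ᵉ edgeOf ε k)
      lookup-weighted x ρ k = trans (lookup-· ε ρ (weighted x) k)
        (trans (Vec.lookup∘tabulate (weight x ∘ edgeOf ε) (indexOf ε (flip ρ ·ᵉ edgeOf ε k)))
          (cong (weight x) (Inverse.strictlyInverseˡ ε (flip ρ ·ᵉ edgeOf ε k))))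

      -- Were another edge moved to `e₀`, its weight there would be beaten by `w₂` in a translate
      -- moving `x` to `e₀`, which exists by transitivity on edges.
      top : ∀ x ρ → Max (ρ ∙ weighted x) → flip ρ ·ᵉ e₀ ≡ x
      top x ρ ρ-max with (flip ρ ·ᵉ e₀) ≟ᵉ x
      ... | yes ρ⁻¹e₀≡x = ρ⁻¹e₀≡x
      ... | no  ρ⁻¹e₀≢x with ·ᵉ-transitive x e₀
      ...   | π , πx≡e₀ = ⊥-elim (maximal-≮ {weighted x} ρ π ρ-max
        (first (ρ ∙ weighted x) (π ∙ weighted x)
          (subst₂ _◁_ (sym (lookup-weighted x ρ k₀)) (sym πx-weight) (weight-≢ ρ⁻¹e₀≢x))))
        where
        πx-weight : lookup (π ∙ weighted x) k₀ ≡ w₂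
        πx-weight = trans (lookup-weighted x π k₀)
          (trans (cong (weight x) (trans (cong (flip π ·ᵉ_) (sym πx≡e₀)) (·ᵉ-flipˡ π x))) (weight-≡ x))

      -- `Adjacent` is reflexive, so `b` belongs to the set that `θ` marks, and `x = b` is a
      -- legitimate choice.
      b~b : Adjacent b b
      b~b = lo b , inj₁ refl , inj₁ refl

      support : Vec.map θ (weighted a) ≡ Vec.map θ (weighted b)
      support = trans (sym (Vec.tabulate-∘ θ (weight a ∘ edgeOf ε)))
        (trans (Vec.tabulate-cong λ k → θ-weight (adjacent? (edgeOf ε k) b))
          (Vec.tabulate-∘ θ (weight b ∘ edgeOf ε)))
        where
        θ-weight : ∀ {e} → Dec (Adjacent e b) → θ (weight a e) ≡ θ (weight b e)
        θ-weight (yes e~b) = trans (θ-weight-~ a e~b) (sym (θ-weight-~ b e~b))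
        θ-weight (no  e≁b) = trans (θ-weight-≁ a~b e≁b) (sym (θ-weight-≁ b~b e≁b))

      -- The two maximal translates have equal `θ`-images, so `σ` and `τ` send the neighbours of `b`
      -- to the same edges. As `σ` sends `b` to `e₀`, the edge `τ ·ᵉ c` is adjacent to `e₀`; as `τ`
      -- sends `a` to `e₀`, the edge `c` is adjacent to `a`.
      conclude : ∃[ σ ] Max (σ ∙ weighted b) → ∃[ τ ] Max (τ ∙ weighted a) → ⊥
      conclude (σ , σ-max) (τ , τ-max) = c≁a
        (subst₂ Adjacent (·ᵉ-flipˡ τ c) (top a τ τ-max) (Adjacent-·ᵉ (flip τ) (τ ·ᵉ c) e₀ τc~e₀))
        where
        supports-agree : Vec.map θ (σ ∙ weighted b) ≡ Vec.map θ (τ ∙ weighted a)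
        supports-agree = trans (sym (·-map ε σ θ (weighted b)))
          (trans (maximal-unique {Vec.map θ (weighted b)} σ τ
            (subst Max (sym (·-map ε σ θ (weighted b))) (maximal-map-weak fg θ-mono σ-max))
            (subst Max (trans (sym (·-map ε τ θ (weighted a))) (cong (τ ∙_) support))
              (maximal-map-weak fg θ-mono τ-max)))
          (trans (cong (τ ∙_) (sym support)) (·-map ε τ θ (weighted a))))

        σ⁻¹τc~b : Adjacent (flip σ ·ᵉ (τ ·ᵉ c)) b
        σ⁻¹τc~b with adjacent? (flip σ ·ᵉ (τ ·ᵉ c)) b
        ... | yes ~b = ~b
        ... | no  ≁b = ⊥-elim (θw₀≢θw₁ (begin
          θ w₀                                          ≡⟨ θ-weight-≁ b~b ≁b ⟨
          θ (weight b (flip σ ·ᵉ (τ ·ᵉ c)))             ≡⟨ θ-lookup b σ ⟨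
          lookup (Vec.map θ (σ ∙ weighted b)) k         ≡⟨ cong (λ m → lookup m k) supports-agree ⟩
          lookup (Vec.map θ (τ ∙ weighted a)) k         ≡⟨ θ-lookup a τ ⟩
          θ (weight a (flip τ ·ᵉ (τ ·ᵉ c)))             ≡⟨ cong (θ ∘ weight a) (·ᵉ-flipˡ τ c) ⟩
          θ (weight a c)                                ≡⟨ θ-weight-~ a c~b ⟩
          θ w₁                                          ∎))
          where
          open ≡-Reasoning
          k : Fin (n C 2)
          k = indexOf ε (τ ·ᵉ c)
          θ-lookup : ∀ x ρ → lookup (Vec.map θ (ρ ∙ weighted x)) k ≡ θ (weight x (flip ρ ·ᵉ (τ ·ᵉ c)))
          θ-lookup x ρ = trans (Vec.lookup-map k θ (ρ ∙ weighted x)) (cong θ (trans (lookup-weighted x ρ k)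
            (cong (λ e → weight x (flip ρ ·ᵉ e)) (Inverse.strictlyInverseˡ ε (τ ·ᵉ c)))))

        τc~e₀ : Adjacent (τ ·ᵉ c) e₀
        τc~e₀ = subst₂ Adjacent (·ᵉ-flipʳ σ (τ ·ᵉ c))
          (trans (cong (σ ·ᵉ_) (sym (top b σ σ-max))) (·ᵉ-flipʳ σ e₀))
          (Adjacent-·ᵉ σ (flip σ ·ᵉ (τ ·ᵉ c)) b σ⁻¹τc~b)

-- Polynomials and initial monomials

⊕-cancelˡ : (p : Monomial N) {q r : Monomial N} → p ⊕ q ≡ p ⊕ r → q ≡ r
⊕-cancelˡ []      {[]}    {[]}    _       = refl
⊕-cancelˡ (x ∷ p) {y ∷ q} {z ∷ r} x+y≡x+z =
  cong₂ _∷_ (ℕ.+-cancelˡ-≡ x y z (Vec.∷-injectiveˡ x+y≡x+z)) (⊕-cancelˡ p (Vec.∷-injectiveʳ x+y≡x+z))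

⊕-∸ : (p q : Monomial N) → zipWith ℕ._∸_ (p ⊕ q) p ≡ q
⊕-∸ []      []      = refl
⊕-∸ (x ∷ p) (y ∷ q) = cong₂ _∷_ (ℕ.m+n∸m≡n x y) (⊕-∸ p q)

lookup≤degree : (m : Monomial N) → Bounded (degree m) m
lookup≤degree (x ∷ m) Fin.zero    = ℕ.m≤m+n x _
lookup≤degree (x ∷ m) (Fin.suc k) = ℕ.≤-trans (lookup≤degree m k) (ℕ.m≤n+m _ x)

module _ {c ℓ₁ ℓ₂} (K : HeytingField c ℓ₁ ℓ₂) where

  private
    module K = HeytingField K
    R : CommutativeRing c ℓ₁
    R = HeytingCommutativeRing.commutativeRing K.heytingCommutativeRing
    module R = CommutativeRing R
    open R using (_≈_; 0#; 1#) renaming (_+_ to _+ᴷ_; _*_ to _*ᴷ_)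
    open HeytingCommutativeRingProperties K.heytingCommutativeRing using (1#0; #-congʳ)
    open import Relation.Binary.Reasoning.Setoid R.setoid
    module +ᴷ = CommutativeSemigroupProperties R.+-commutativeSemigroup

    _∗_ : K.Carrier × Monomial N → K.Carrier × Monomial N → K.Carrier × Monomial N
    (a , p) ∗ (b , q) = a *ᴷ b , p ⊕ q

    infixl 7 _⋆_
    _⋆_ : Poly K N → Poly K N → Poly K N
    _⋆_ = _*ᵖ_ K

    _≈ₚ_ : Rel (Poly K N) ℓ₁
    _≈ₚ_ = _≈ᵖ_ K

  module _ {N : ℕ} where

    private
      coef : Poly K N → Monomial N → K.Carrier
      coef = coeff K

    coeff-∷-≡ : ∀ a p (f : Poly K N) → coef ((a , p) ∷ f) p ≈ a +ᴷ coef f p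
    coeff-∷-≡ a p f with p ≟ᵐ p
    ... | yes _  = R.refl
    ... | no p≢p = ⊥-elim (p≢p refl)

    coeff-∷-≢ : ∀ {a p m} → p ≢ m → (f : Poly K N) → coef ((a , p) ∷ f) m ≈ coef f m
    coeff-∷-≢ {a} {p} {m} p≢m f with p ≟ᵐ m
    ... | yes p≡m = ⊥-elim (p≢m p≡m)
    ... | no _    = R.+-identityˡ _

    coeff-∷-cong : ∀ {a b} p (f g : Poly K N) m → a ≈ b → coef f m ≈ coef g m →
      coef ((a , p) ∷ f) m ≈ coef ((b , p) ∷ g) m
    coeff-∷-cong p f g m a≈b f≈g with p ≟ᵐ m
    ... | yes _ = R.+-cong a≈b f≈g
    ... | no _  = R.+-congˡ f≈g

    coeff-++ : ∀ (f g : Poly K N) m → coef (f ++ g) m ≈ coef f m +ᴷ coef g m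
    coeff-++ []            g m = R.sym (R.+-identityˡ _)
    coeff-++ ((a , p) ∷ f) g m = R.trans (R.+-congˡ (coeff-++ f g m)) (R.sym (R.+-assoc _ _ _))

    ++-cong : ∀ (f f′ g g′ : Poly K N) → f ≈ₚ f′ → g ≈ₚ g′ → (f ++ g) ≈ₚ (f′ ++ g′)
    ++-cong f f′ g g′ f≈f′ g≈g′ m =
      R.trans (coeff-++ f g m) (R.trans (R.+-cong (f≈f′ m) (g≈g′ m)) (R.sym (coeff-++ f′ g′ m)))

    coeff-∉ : ∀ (f : Poly K N) {m} → (∀ {t} → t ∈ f → proj₂ t ≢ m) → coef f m ≈ 0#
    coeff-∉ []            m∉f = R.refl
    coeff-∉ ((a , p) ∷ f) m∉f = R.trans (coeff-∷-≢ (m∉f (here refl)) f) (coeff-∉ f (m∉f ∘ there))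

    -- Occurrence in the list of terms is decidable, so a witness is found without deciding equality
    -- of coefficients.
    occurs : ∀ (f : Poly K N) {m} → coef f m K.# 0# → ∃[ t ] t ∈ f × proj₂ t ≡ m
    occurs f {m} fₘ#0 with Any.any? (λ t → proj₂ t ≟ᵐ m) f
    ... | yes m∈f = find m∈f
    ... | no  m∉f = ⊥-elim (K.#-irrefl (coeff-∉ f (λ t∈f t≡m → m∉f (lose t∈f t≡m))) fₘ#0)

    coeff-map-∗ : ∀ a p (g : Poly K N) r → coef (List.map ((a , p) ∗_) g) (p ⊕ r) ≈ a *ᴷ coef g r
    coeff-map-∗ a p []            r = R.sym (R.zeroʳ a)
    coeff-map-∗ a p ((b , q) ∷ g) r = by-cases (q ≟ᵐ r)
      where
      by-cases : Dec (q ≡ r) → coef (List.map ((a , p) ∗_) ((b , q) ∷ g)) (p ⊕ r) ≈ a *ᴷ coef ((b , q) ∷ g) r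
      by-cases (yes refl) = begin
        coef (List.map ((a , p) ∗_) ((b , q) ∷ g)) (p ⊕ q)           ≈⟨ coeff-∷-≡ (a *ᴷ b) (p ⊕ q) (List.map ((a , p) ∗_) g) ⟩
        a *ᴷ b +ᴷ coef (List.map ((a , p) ∗_) g) (p ⊕ q)             ≈⟨ R.+-congˡ (coeff-map-∗ a p g q) ⟩
        a *ᴷ b +ᴷ a *ᴷ coef g q                                      ≈⟨ R.distribˡ a b _ ⟨
        a *ᴷ (b +ᴷ coef g q)                                         ≈⟨ R.*-congˡ (coeff-∷-≡ b q g) ⟨
        a *ᴷ coef ((b , q) ∷ g) q                                    ∎
      by-cases (no q≢r) = begin
        coef (List.map ((a , p) ∗_) ((b , q) ∷ g)) (p ⊕ r)           ≈⟨ coeff-∷-≢ (q≢r ∘ ⊕-cancelˡ p) (List.map ((a , p) ∗_) g) ⟩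
        coef (List.map ((a , p) ∗_) g) (p ⊕ r)                       ≈⟨ coeff-map-∗ a p g r ⟩
        a *ᴷ coef g r                                                ≈⟨ R.*-congˡ (coeff-∷-≢ q≢r g) ⟨
        a *ᴷ coef ((b , q) ∷ g) r                                    ∎

    map-∗-cong : ∀ t (g g′ : Poly K N) → g ≈ₚ g′ → List.map (t ∗_) g ≈ₚ List.map (t ∗_) g′
    map-∗-cong (a , p) g g′ g≈g′ m = by-cases ((p ⊕ r) ≟ᵐ m)
      where
      -- With truncated subtraction, `p ⊕ r ≡ m` holds exactly when the monomial `p` divides `m`;
      -- otherwise `m` occurs in neither product.
      r : Monomial N
      r = zipWith ℕ._∸_ m p

      avoids : p ⊕ r ≢ m → ∀ (h : Poly K N) {t} → t ∈ List.map ((a , p) ∗_) h → proj₂ t ≢ m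
      avoids p⊕r≢m h t∈ refl with ∈-map⁻ ((a , p) ∗_) t∈
      ... | (_ , q) , _ , refl = p⊕r≢m (cong (p ⊕_) (⊕-∸ p q))

      by-cases : Dec (p ⊕ r ≡ m) → coef (List.map ((a , p) ∗_) g) m ≈ coef (List.map ((a , p) ∗_) g′) m
      by-cases (yes p⊕r≡m) = subst
        (λ m → coef (List.map ((a , p) ∗_) g) m ≈ coef (List.map ((a , p) ∗_) g′) m) p⊕r≡m
        (R.trans (coeff-map-∗ a p g r) (R.trans (R.*-congˡ (g≈g′ r)) (R.sym (coeff-map-∗ a p g′ r))))
      by-cases (no p⊕r≢m)  =
        R.trans (coeff-∉ _ (avoids p⊕r≢m g)) (R.sym (coeff-∉ _ (avoids p⊕r≢m g′)))

    ⋆-congʳ : ∀ (f g g′ : Poly K N) → g ≈ₚ g′ → (f ⋆ g) ≈ₚ (f ⋆ g′)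
    ⋆-congʳ []      g g′ g≈g′ m = R.refl
    ⋆-congʳ (t ∷ f) g g′ g≈g′ = ++-cong (List.map (t ∗_) g) (List.map (t ∗_) g′) (f ⋆ g) (f ⋆ g′)
      (map-∗-cong t g g′ g≈g′) (⋆-congʳ f g g′ g≈g′)

    ⋆-[] : ∀ (f : Poly K N) → f ⋆ [] ≡ []
    ⋆-[] []      = refl
    ⋆-[] (t ∷ f) = ⋆-[] f

    -- Expands along the first term of the right factor, whereas `_⋆_` recurses on the left one;
    -- matching the two expansions gives commutativity.
    coeff-⋆-∷ : ∀ (f : Poly K N) t g m → coef (f ⋆ (t ∷ g)) m ≈ coef (List.map (_∗ t) f) m +ᴷ coef (f ⋆ g) m
    coeff-⋆-∷ []      t g m = R.sym (R.+-identityˡ _)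
    coeff-⋆-∷ (s ∷ f) t g m = begin
      coef ((s ∗ t) ∷ List.map (s ∗_) g ++ f ⋆ (t ∷ g)) m
        ≈⟨ R.+-congˡ (R.trans (coeff-++ (List.map (s ∗_) g) _ m) (R.+-congˡ (coeff-⋆-∷ f t g m))) ⟩
      _ +ᴷ (coef (List.map (s ∗_) g) m +ᴷ (coef (List.map (_∗ t) f) m +ᴷ coef (f ⋆ g) m))
        ≈⟨ R.+-congˡ (+ᴷ.x∙yz≈y∙xz _ _ _) ⟩
      _ +ᴷ (coef (List.map (_∗ t) f) m +ᴷ (coef (List.map (s ∗_) g) m +ᴷ coef (f ⋆ g) m))
        ≈⟨ R.+-assoc _ _ _ ⟨
      coef (List.map (_∗ t) (s ∷ f)) m +ᴷ (coef (List.map (s ∗_) g) m +ᴷ coef (f ⋆ g) m)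
        ≈⟨ R.+-congˡ (coeff-++ (List.map (s ∗_) g) (f ⋆ g) m) ⟨
      coef (List.map (_∗ t) (s ∷ f)) m +ᴷ coef ((s ∷ f) ⋆ g) m ∎

    map-∗-comm : ∀ t (f : Poly K N) → List.map (t ∗_) f ≈ₚ List.map (_∗ t) f
    map-∗-comm t       []            m = R.refl
    map-∗-comm (a , p) ((b , q) ∷ f) m = R.trans
      (coeff-∷-cong (p ⊕ q) (List.map ((a , p) ∗_) f) (List.map (_∗ (a , p)) f) m
        (R.*-comm a b) (map-∗-comm (a , p) f m))
      (R.reflexive (cong (λ r → coef ((b *ᴷ a , r) ∷ List.map (_∗ (a , p)) f) m) (Vec.zipWith-comm ℕ.+-comm p q)))

    ⋆-comm : ∀ (f g : Poly K N) → (f ⋆ g) ≈ₚ (g ⋆ f)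
    ⋆-comm []      g m = R.reflexive (cong (λ h → coef h m) (sym (⋆-[] g)))
    ⋆-comm (t ∷ f) g m = begin
      coef (List.map (t ∗_) g ++ f ⋆ g) m                   ≈⟨ coeff-++ (List.map (t ∗_) g) (f ⋆ g) m ⟩
      coef (List.map (t ∗_) g) m +ᴷ coef (f ⋆ g) m          ≈⟨ R.+-cong (map-∗-comm t g m) (⋆-comm f g m) ⟩
      coef (List.map (_∗ t) g) m +ᴷ coef (g ⋆ f) m          ≈⟨ coeff-⋆-∷ g t f m ⟨
      coef (g ⋆ (t ∷ f)) m                                  ∎

    -- Equal polynomials may have quite different lists of terms, so the left factor is not changed
    -- by recursion but moved to the right by commutativity.
    ⋆-cong : ∀ (f f′ g g′ : Poly K N) → f ≈ₚ f′ → g ≈ₚ g′ → (f ⋆ g) ≈ₚ (f′ ⋆ g′)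
    ⋆-cong f f′ g g′ f≈f′ g≈g′ m = R.trans (⋆-congʳ f g g′ g≈g′ m)
      (R.trans (⋆-comm f g′ m) (R.trans (⋆-congʳ g′ f f′ f≈f′ m) (⋆-comm g′ f′ m)))

    -- Algebras generated by monomials

    module _ {s} {S : Pred (Monomial N) s} where

      -- The list `f` itself may contain cancelling terms outside the monoid, by `resp`. Hence the
      -- claim is about some equal list `g`, which `resp` leaves as it is.
      generatedAlgebra⇒generated : ∀ {f} → GeneratedAlgebra K S f →
        ∃[ g ] f ≈ₚ g × (∀ {t} → t ∈ g → Generated S (proj₂ t))
      generatedAlgebra⇒generated (generator {m} m∈S) =
        monomial K m , (λ _ → R.refl) , λ { (here refl) → gen m∈S }
      generatedAlgebra⇒generated (const a) =
        constant K a , (λ _ → R.refl) , λ { (here refl) → unit }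
      generatedAlgebra⇒generated (add {f₁} {f₂} p q)
        with generatedAlgebra⇒generated p | generatedAlgebra⇒generated q
      ... | g₁ , f₁≈g₁ , gen₁ | g₂ , f₂≈g₂ , gen₂ =
        g₁ ++ g₂ , ++-cong f₁ g₁ f₂ g₂ f₁≈g₁ f₂≈g₂ , λ t∈ → [ gen₁ , gen₂ ]′ (∈-++⁻ g₁ t∈)
      generatedAlgebra⇒generated (mul {f₁} {f₂} p q)
        with generatedAlgebra⇒generated p | generatedAlgebra⇒generated q
      ... | g₁ , f₁≈g₁ , gen₁ | g₂ , f₂≈g₂ , gen₂ =
        g₁ ⋆ g₂ , ⋆-cong f₁ g₁ f₂ g₂ f₁≈g₁ f₂≈g₂ , λ t∈ → mul-∗ (∈-cartesianProductWith⁻ _∗_ g₁ g₂ t∈)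
        where
        mul-∗ : ∀ {t} → (∃[ u ] ∃[ v ] u ∈ g₁ × v ∈ g₂ × t ≡ u ∗ v) → Generated S (proj₂ t)
        mul-∗ (_ , _ , u∈ , v∈ , refl) = mul (gen₁ u∈) (gen₂ v∈)
      generatedAlgebra⇒generated (resp f≈g p) with generatedAlgebra⇒generated p
      ... | h , f≈h , gen-h = h , (λ m → R.trans (R.sym (f≈g m)) (f≈h m)) , gen-h

      -- If `m` were missing from the representative `g`, its coefficient would be both `1#` and
      -- `0#`.
      monomial⇒generated : ∀ {m} → GeneratedAlgebra K S (monomial K m) → Generated S m
      monomial⇒generated {m} p with generatedAlgebra⇒generated p
      ... | g , xᵐ≈g , gen-g with Any.any? (λ t → proj₂ t ≟ᵐ m) g
      ...   | yes m∈g = let t , t∈g , t≡m = find m∈g in subst (Generated S) t≡m (gen-g t∈g)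
      ...   | no  m∉g = ⊥-elim (K.#-irrefl 1≈0 1#0)
        where
        1≈0 : 1# ≈ 0#
        1≈0 = begin
          1#                    ≈⟨ R.+-identityʳ 1# ⟨
          1# +ᴷ 0#              ≈⟨ coeff-∷-≡ 1# m [] ⟨
          coef (monomial K m) m ≈⟨ xᵐ≈g m ⟩
          coef g m              ≈⟨ coeff-∉ g (λ t∈g t≡m → m∉g (lose t∈g t≡m)) ⟩
          0#                    ∎

    degree-bound : Poly K N → ℕ
    degree-bound = List.foldr (λ t s → degree (proj₂ t) + s) 0

    bounded-∈ : ∀ {f : Poly K N} {t} → t ∈ f → Bounded (degree-bound f) (proj₂ t)
    bounded-∈ {t ∷ f} (here refl) k = ℕ.≤-trans (lookup≤degree (proj₂ t) k) (ℕ.m≤m+n _ _)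
    bounded-∈ {t ∷ f} (there t∈)  k = ℕ.≤-trans (bounded-∈ t∈ k) (ℕ.m≤n+m _ (degree (proj₂ t)))

    -- For an orbit this is the orbit sum.
    indicator : List (Monomial N) → Poly K N
    indicator = List.map (1# ,_)

    coeff-indicator-∉ : ∀ {O m} → ¬ (m ∈ O) → coef (indicator O) m ≈ 0#
    coeff-indicator-∉ {O} {m} m∉O = coeff-∉ (indicator O) avoids
      where
      avoids : ∀ {t} → t ∈ indicator O → proj₂ t ≢ m
      avoids t∈ refl with ∈-map⁻ (1# ,_) t∈
      ... | _ , p∈O , refl = m∉O p∈O

    coeff-indicator-∈ : ∀ {O m} → Unique O → m ∈ O → coef (indicator O) m ≈ 1#
    coeff-indicator-∈ {m ∷ O} (m# ∷ _) (here refl) = begin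
      coef (indicator (m ∷ O)) m     ≈⟨ coeff-∷-≡ 1# m (indicator O) ⟩
      1# +ᴷ coef (indicator O) m     ≈⟨ R.+-congˡ (coeff-indicator-∉ λ m∈O → All.lookup m# m∈O refl) ⟩
      1# +ᴷ 0#                       ≈⟨ R.+-identityʳ 1# ⟩
      1#                             ∎
    coeff-indicator-∈ {_ ∷ O} (p# ∷ O!) (there m∈O) =
      R.trans (coeff-∷-≢ (All.lookup p# m∈O) (indicator O)) (coeff-indicator-∈ O! m∈O)

    indicator-≈ : ∀ {O O′} → Unique O → Unique O′ → (∀ {m} → m ∈ O → m ∈ O′) → (∀ {m} → m ∈ O′ → m ∈ O) →
      indicator O ≈ₚ indicator O′
    indicator-≈ {O} {O′} O! O′! O⊆O′ O′⊆O m with _∈?_ _≟ᵐ_ m O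
    ... | yes m∈O = R.trans (coeff-indicator-∈ O! m∈O) (R.sym (coeff-indicator-∈ O′! (O⊆O′ m∈O)))
    ... | no  m∉O = R.trans (coeff-indicator-∉ m∉O) (R.sym (coeff-indicator-∉ (m∉O ∘ O′⊆O)))

  -- Invariants and their initial monomials

  module _ {n : ℕ} (ε : VariableOrder n) where

    ·-injective : ∀ σ {p q} → actᵐ ε σ p ≡ actᵐ ε σ q → p ≡ q
    ·-injective σ {p} {q} σp≡σq =
      trans (sym (·-flipˡ ε σ p)) (trans (cong (actᵐ ε (flip σ)) σp≡σq) (·-flipˡ ε σ q))

    coeff-act : ∀ σ (f : Poly K (n C 2)) m → coeff K (act K ε σ f) (actᵐ ε σ m) ≈ coeff K f m
    coeff-act σ []            m = R.refl
    coeff-act σ ((a , p) ∷ f) m = by-cases (p ≟ᵐ m)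
      where
      by-cases : Dec (p ≡ m) → coeff K (act K ε σ ((a , p) ∷ f)) (actᵐ ε σ m) ≈ coeff K ((a , p) ∷ f) m
      by-cases (yes refl) = R.trans (coeff-∷-≡ a _ (act K ε σ f))
        (R.trans (R.+-congˡ (coeff-act σ f m)) (R.sym (coeff-∷-≡ a p f)))
      by-cases (no p≢m)   = R.trans (coeff-∷-≢ (p≢m ∘ ·-injective σ) (act K ε σ f))
        (R.trans (coeff-act σ f m) (R.sym (coeff-∷-≢ p≢m f)))

    orbit-invariant : ∀ m → Invariant K ε (indicator (orbit ε m))
    orbit-invariant m σ p = R.trans (R.reflexive (cong (λ f → coeff K f p) act-indicator))
      (indicator-≈ (Unique.map⁺ (·-injective σ) (orbit-unique ε m)) (orbit-unique ε m) σO⊆O O⊆σO p)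
      where
      O : List (Monomial (n C 2))
      O = orbit ε m

      act-indicator : act K ε σ (indicator O) ≡ indicator (List.map (actᵐ ε σ) O)
      act-indicator = trans (sym (List.map-∘ O)) (List.map-∘ O)

      σO⊆O : ∀ {q} → q ∈ List.map (actᵐ ε σ) O → q ∈ O
      σO⊆O q∈ with ∈-map⁻ (actᵐ ε σ) q∈
      ... | r , r∈O , refl with ∈-orbit⁻ ε m r∈O
      ...   | τ , refl = subst (_∈ O) (·-∘ ε τ σ m) (∈-orbit⁺ ε (τ ∘ₚ σ) m)

      O⊆σO : ∀ {q} → q ∈ O → q ∈ List.map (actᵐ ε σ) O
      O⊆σO q∈ with ∈-orbit⁻ ε m q∈
      ... | τ , refl = subst (_∈ List.map (actᵐ ε σ) O)
        (trans (cong (actᵐ ε σ) (·-∘ ε τ (flip σ) m)) (·-flipʳ ε σ (actᵐ ε τ m)))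
        (∈-map⁺ (actᵐ ε σ) (∈-orbit⁺ ε (τ ∘ₚ flip σ) m))

    module _ (_≺_ : Rel (Monomial (n C 2)) 0ℓ) where

      -- The orbit sum of `m` is invariant, has coefficient `1#` at `m`, and is supported on
      -- translates of `m`, none of which is larger.
      maximal⇒initial : ∀ {m} → Maximal ε _≺_ m → InitialMonomials K _≺_ (Invariant K ε) m
      maximal⇒initial {m} m-max = indicator (orbit ε m) , orbit-invariant m , #0 , λ p m≺p →
        coeff-indicator-∉ λ p∈ → let σ , p≡σm = ∈-orbit⁻ ε m p∈ in m-max σ (subst (m ≺_) p≡σm m≺p)
        where
        #0 : coeff K (indicator (orbit ε m)) m K.# 0#
        #0 = #-congʳ
          (R.sym (coeff-indicator-∈ (orbit-unique ε m) (subst (_∈ orbit ε m) (·-id ε m) (∈-orbit⁺ ε Perm.id m)))) 1#0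

      -- By invariance the coefficient at `σ · m` equals the one at `m`, which is apart from zero;
      -- above an initial monomial it would have to vanish.
      initial⇒maximal : ∀ {f m} → Invariant K ε f → IsInitialMonomial K _≺_ f m → Maximal ε _≺_ m
      initial⇒maximal {f} {m} f-inv (fₘ#0 , above≈0) σ m≺σm = K.#-irrefl
        (R.trans (R.sym (R.trans (R.sym (f-inv σ (actᵐ ε σ m))) (coeff-act σ f m))) (above≈0 _ m≺σm)) fₘ#0

      finiteSAGBIBasis⇒ : HasFiniteSAGBIBasis K _≺_ (Invariant K ε) → FinitelyGeneratedMaxima ε _≺_
      -- A maximal `v` is initial, so its monomial lies in the algebra generated by the initial
      -- monomials of `L`, and `v` is a product of these. Concatenating `L` yields one exponent
      -- bound for all of them.
      finiteSAGBIBasis⇒ (L , L⊆I , sagbi) = degree-bound (List.concat L) , λ v v-max →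
        generated-mono
          (λ { (f , f∈L , fₘ#0 , above≈0) →
             let t , t∈f , t≡m = occurs f fₘ#0 in
             subst (Bounded _) t≡m (bounded-∈ (∈-concat⁺′ t∈f f∈L))
             , initial⇒maximal {f} (L⊆I f∈L) (fₘ#0 , above≈0) })
          (monomial⇒generated (Equivalence.from (sagbi (monomial K v)) (element (maximal⇒initial v-max))))

-- The three monomial orders

opposite-< : {i j : Fin N} → i Fin.< j → Fin.opposite j Fin.< Fin.opposite i
opposite-< {i = i} {j} i<j = subst₂ _<_ (sym (Fin.opposite-prop j)) (sym (Fin.opposite-prop i))
  (ℕ.∸-monoʳ-< (s≤s i<j) (Fin.toℕ<n j))

RevLex⇒LexAlong : (p q : Monomial N) → RevLex p q → LexAlong Perm.reverse q p
RevLex⇒LexAlong p q (k , qk<pk , p≗q) = Fin.opposite k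
  , subst (λ i → lookup q i < lookup p i) (sym (Fin.opposite-involutive k)) qk<pk
  , λ l l<k′ → sym (p≗q (Fin.opposite l)
      (subst (Fin._< Fin.opposite l) (Fin.opposite-involutive k) (opposite-< l<k′)))

LexAlong⇒RevLex : (p q : Monomial N) → LexAlong Perm.reverse q p → RevLex p q
LexAlong⇒RevLex p q (k , qk<pk , q≗p) = Fin.opposite k , qk<pk , λ l k′<l →
  subst (λ i → lookup p i ≡ lookup q i) (Fin.opposite-involutive l)
    (sym (q≗p (Fin.opposite l) (subst (Fin.opposite l Fin.<_) (Fin.opposite-involutive k) (opposite-< k′<l))))

least : Fin N → Σ[ k ∈ Fin N ] (∀ (l : Fin N) → ¬ (l Fin.< k))
least {suc N} _ = Fin.zero , λ _ ()

lexAlong-first : (s : Permutation′ N) → Fin N →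
  ∃[ k₀ ] (∀ p q → lookup p k₀ < lookup q k₀ → LexAlong s p q)
lexAlong-first s k with least k
... | k₀ , k₀-least = s ⟨$⟩ʳ k₀ , λ p q p<q → k₀ , p<q , λ l l<k₀ → ⊥-elim (k₀-least l l<k₀)

module _ {n : ℕ} (ε : VariableOrder (4 ℕ.+ n)) (s : Permutation′ ((4 ℕ.+ n) C 2)) where

  private
    -- The path 2 - 0 - 1 - 3: its end edges are disjoint and both meet the middle edge `e₀₁`, which
    -- plays the role of `b`.
    e₀₁ e₀₂ e₁₃ : Edge (4 ℕ.+ n)
    e₀₁ = edge 0F 1F (s≤s z≤n)
    e₀₂ = edge 0F 2F (s≤s z≤n)
    e₁₃ = edge 1F 3F (s≤s (s≤s z≤n))

    e₀₂~e₀₁ : Adjacent e₀₂ e₀₁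
    e₀₂~e₀₁ = 0F , inj₁ refl , inj₁ refl

    e₁₃~e₀₁ : Adjacent e₁₃ e₀₁
    e₁₃~e₀₁ = 1F , inj₁ refl , inj₂ refl

    e₁₃≁e₀₂ : ¬ Adjacent e₁₃ e₀₂
    e₁₃≁e₀₂ (_ , inj₁ refl , inj₁ ())
    e₁₃≁e₀₂ (_ , inj₁ refl , inj₂ ())
    e₁₃≁e₀₂ (_ , inj₂ refl , inj₁ ())
    e₁₃≁e₀₂ (_ , inj₂ refl , inj₂ ())

    -- The index of any edge shows that there is a variable to be inspected first.
    first : ∃[ k₀ ] (∀ p q → lookup p k₀ < lookup q k₀ → LexAlong s p q)
    first = lexAlong-first s (indexOf ε e₀₁)

  lexAlong-maxima : ¬ FinitelyGeneratedMaxima ε (LexAlong s)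
  lexAlong-maxima = maxima-not-finitelyGenerated ε (lexAlong-lexLike s)
    -- The special edge has the largest exponent 2. Truncation at 1 merges 1 with 2 and keeps 0
    -- apart.
    {_◁_ = _<_} (proj₂ first) {θ = 1 ℕ.⊓_} (ℕ.⊓-monoʳ-≤ 1) {0} {1} {2} (s≤s z≤n) (s≤s (s≤s z≤n)) refl (λ ())
    e₀₂ e₀₁ e₁₃ e₀₂~e₀₁ e₁₃~e₀₁ e₁₃≁e₀₂

  lexAlong-minima : ¬ FinitelyGeneratedMaxima ε (λ p q → LexAlong s q p)
  lexAlong-minima = maxima-not-finitelyGenerated ε (flip-lexLike (lexAlong-lexLike s))
    -- With the comparison reversed, the special edge has the smallest exponent 0. Truncated
    -- subtraction of 1 merges 0 with 1 and keeps 2 apart.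
    {_◁_ = ℕ._>_} (λ p q → proj₂ first q p) {θ = ℕ._∸ 1} (ℕ.∸-monoˡ-≤ 1) {2} {1} {0} (s≤s z≤n) (s≤s z≤n) refl (λ ())
    e₀₂ e₀₁ e₁₃ e₀₂~e₀₁ e₁₃~e₀₁ e₁₃≁e₀₂

theorem2p2 : ∀ {c ℓ₁ ℓ₂} (K : HeytingField c ℓ₁ ℓ₂) → CharacteristicZero K →
    (n : ℕ) → 4 ≤ n → (ε : VariableOrder n) →
    ¬ HasFiniteSAGBIBasis K Lex (Invariant K ε)
    × ¬ HasFiniteSAGBIBasis K DegLex (Invariant K ε)
    × (SmallestAdjacent ε → ¬ HasFiniteSAGBIBasis K DegRevLex (Invariant K ε))
theorem2p2 K _ (suc (suc (suc (suc n)))) (s≤s (s≤s (s≤s (s≤s z≤n)))) ε =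
    (λ h → lexAlong-maxima ε Perm.id
      (finitelyGeneratedMaxima-resp ε Lex (LexAlong Perm.id)
        (λ σ p → Lex⇒<ˡ) (λ σ p → <ˡ⇒Lex) (finiteSAGBIBasis⇒ K ε Lex h)))
  , (λ h → lexAlong-maxima ε Perm.id
      (finitelyGeneratedMaxima-resp ε DegLex (LexAlong Perm.id)
        (λ σ p p<σp → Lex⇒<ˡ (ungrade Lex σ p p<σp))
        (λ σ p p<σp → inj₂ (sym (degree-· ε σ p) , <ˡ⇒Lex p<σp)) (finiteSAGBIBasis⇒ K ε DegLex h)))
  , λ _ h → lexAlong-minima ε Perm.reverse
      (finitelyGeneratedMaxima-resp ε DegRevLex (λ p q → LexAlong Perm.reverse q p)
        (λ σ p p<σp → RevLex⇒LexAlong p (actᵐ ε σ p) (ungrade RevLex σ p p<σp))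
        (λ σ p σp<p → inj₂ (sym (degree-· ε σ p) , LexAlong⇒RevLex p (actᵐ ε σ p) σp<p))
        (finiteSAGBIBasis⇒ K ε DegRevLex h))
  where
  -- A translate has the same degree, so the comparison is never settled by degree.
  ungrade : ∀ (_≺_ : Rel (Monomial _) 0ℓ) σ p →
    degree p < degree (actᵐ ε σ p) ⊎ (degree p ≡ degree (actᵐ ε σ p) × p ≺ actᵐ ε σ p) → p ≺ actᵐ ε σ p
  ungrade _ σ p (inj₁ p<σp)       = ⊥-elim (ℕ.<⇒≢ p<σp (sym (degree-· ε σ p)))
  ungrade _ σ p (inj₂ (_ , p≺σp)) = p≺σp
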